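{- Let a layered convex combination of spanning trees $\mathcal{S}$ (with lonely edge sets $L(S)$) be given, let $S$ be a tree in it, and let $F=S\setminus L(S)$. Fix $\gamma\in[0,\tfrac12]$, let $y_F$ be the vector defined in the context, and let $\mathcal{J}_F$ be a random $T_F\triangle\{s,t\}$-join with $\mathbb{E}[\mathcal{J}_F]=y_F$. For an edge set $J$, let $2D_{F+J}$ be the doubled edge set of a minimum $c$-cost spanning tree of the graph obtained by contracting the connected components of $(V,F+J)$. Then $\mathbb{E}\left[c(2D_{F+\mathcal{J}_F})\right]\le\sum_{Q\in\mathcal{Q}(S)}(x^*(Q)-1)\,c(e_S^Q).$
   Context: $V$ is a finite set, $s,t\in V$, $c:\binom V2\to\mathbb{Q}_{\ge0}$ satisfies the triangle inequality. $\delta(U)$ is the set of pairs with exactly one endpoint in $U$. $x^*$ is an optimal solution of the subtour elimination LP for the $s$-$t$ path TSP: minimize $\sum c(e)x(e)$ s.t. $x\ge0$, $x(\delta(\{i\}))=f(\{i\})$ for $i\in V$, $x(\delta(U))\ge f(U)$ for $\emptyset\ne U\subsetneq V$, where $f(U)=1$ if $|U\cap\{s,t\}|=1$ and $2$ otherwise. $E$ is the support of $x^*$; edge sets are identified with incidence vectors and $z(H)=\sum_{e\in H}z(e)$. Narrow cuts: $\mathcal{Q}$ is the set of $Q=\delta(U)\cap E$ ($\emptyset\ne U\subsetneq V$) with $x^*(Q)<2$. $T_X$ denotes the set of odd-degree vertices of an edge set $X$; a $T$-join is an edge set with odd-degree vertex set $T$. $S(s,t)$ is the $s$-$t$ path of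 tree $S$. A convex combination of spanning trees of $(V,E)$, $\lambda_S>0$, $\sum\lambda_S=1$, is viewed as a random tree $\mathcal{S}$; each $S$ has lonely edges $L(S)\subseteq\{e\in S:\exists Q\in\mathcal{Q},Q\cap S=\{e\}\}$; lonely cuts $\mathcal{Q}(S)=\{Q\in\mathcal{Q}:Q\cap S=\{e\},e\in L(S)\}$, with $e_S^Q$ the unique edge of $Q\cap S$; $x^Q(e)=\Pr(Q\in\mathcal{Q}(\mathcal{S}),\ e^Q_{\mathcal{S}}=e)$. A tree $S$ is layered if $Q\in\mathcal{Q}(S)$, $Q'\in\mathcal{Q}$, $x^*(Q')\le x^*(Q)$ imply $Q'\in\mathcal{Q}(S)$. The combination is layered if $\mathbb{E}[\mathcal{S}]=x^*$, $x^Q(Q)=2-x^*(Q)$ for all $Q\in\mathcal{Q}$, and each tree is layered. $y_F=\tfrac12x^*+\gamma S(s,t)+\sum_{Q\in\mathcal{Q}(S):\,x^*(Q)<2-2\gamma}\left(1-\tfrac12x^*(Q)-\gamma\right)e_S^Q+\sum_{Q\in\mathcal{Q}:\,x^*(Q)<2-2\gamma,\ |Q\cap F|\ge2\text{ even}}\frac{1-\frac12x^*(Q)-\gamma}{2-x^*(Q)}x^Q.$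
   Formalization: The parameter γ, the LP solution x*, the coefficients λ_S of the convex combination and the probabilities of the random join are taken to be rational numbers rather than real numbers. -}

module Defs where

open import Data.Bool using (Bool; true; false; _∧_; _∨_; not; if_then_else_; _xor_)
open import Data.Nat as ℕ using (ℕ; zero; suc)
open import Data.Fin as Fin using (Fin)
import Data.Fin.Properties as FinP
open import Data.Maybe using (Maybe; just; nothing)
open import Data.Product using (Σ; _×_; _,_; proj₁; proj₂)
open import Data.Sum using (_⊎_)
open import Data.List using (List; []; _∷_; map; foldr; allFin; concatMap; mapMaybe; filterᵇ; deduplicateᵇ; length)
open import Data.Bool.ListAction using (any; all)
open import Data.Rational as ℚ using (ℚ; 0ℚ; 1ℚ; ½; _+_; _*_; _-_; _≤_; _<_; _÷_)
import Data.Rational.Properties as ℚP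
open import Relation.Nullary using (¬_; yes; no)
open import Relation.Nullary.Decidable using (⌊_⌋)
open import Relation.Binary.PropositionalEquality using (_≡_; _≢_)

2ℚ : ℚ
2ℚ = 1ℚ + 1ℚ

[_] : Bool → ℚ
[ true ]  = 1ℚ
[ false ] = 0ℚ

oddᵇ : ℕ → Bool
oddᵇ zero    = false
oddᵇ (suc k) = not (oddᵇ k)

infix 4 _<ᵇ_
_<ᵇ_ : ℚ → ℚ → Bool
p <ᵇ q = ⌊ p ℚP.<? q ⌋

-- division, used only with nonzero denominators (returns 0 otherwise)
safeDiv : ℚ → ℚ → ℚ
safeDiv p q with q ℚP.≟ 0ℚ
... | yes _  = 0ℚ
... | no q≢0 = _÷_ p q {{ℚ.≢-nonZero q≢0}}

sumℚ : List ℚ → ℚ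
sumℚ = foldr _+_ 0ℚ

Σ[_]_ : {A : Set} → List A → (A → ℚ) → ℚ
Σ[ xs ] f = sumℚ (map f xs)

-- Vertices V = Fin n, edges = unordered pairs {i,j}, represented with i < j

record Edge (n : ℕ) : Set where
  constructor edge
  field
    lo  : Fin n
    hi  : Fin n
    lo<hi : lo Fin.< hi
open Edge public

edges : (n : ℕ) → List (Edge n)
edges n = concatMap (λ i → mapMaybe (mk i) (allFin n)) (allFin n)
  where
  mk : Fin n → Fin n → Maybe (Edge n)
  mk i j with i FinP.<? j
  ... | yes p = just (edge i j p)
  ... | no _  = nothing

_==ᵉ_ : {n : ℕ} → Edge n → Edge n → Bool
e ==ᵉ e' = ⌊ lo e FinP.≟ lo e' ⌋ ∧ ⌊ hi e FinP.≟ hi e' ⌋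

Σₑ : {n : ℕ} → (Edge n → ℚ) → ℚ
Σₑ {n} f = Σ[ edges n ] f

VSet : ℕ → Set
VSet n = Fin n → Bool

ESet : ℕ → Set
ESet n = Edge n → Bool

infix 9 _⟨_⟩
_⟨_⟩ : {n : ℕ} → (Edge n → ℚ) → ESet n → ℚ
z ⟨ H ⟩ = Σₑ (λ e → [ H e ] * z e)

card : {n : ℕ} → ESet n → ℕ
card {n} H = length (filterᵇ H (edges n))

infixr 7 _∩ᵉ_ _∖ᵉ_
infixr 6 _∪ᵉ_
_∩ᵉ_ : {n : ℕ} → ESet n → ESet n → ESet n
(H ∩ᵉ H') e = H e ∧ H' e

_∪ᵉ_ : {n : ℕ} → ESet n → ESet n → ESet n
(H ∪ᵉ H') e = H e ∨ H' e

_∖ᵉ_ : {n : ℕ} → ESet n → ESet n → ESet n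
(H ∖ᵉ H') e = H e ∧ not (H' e)

remove : {n : ℕ} → ESet n → Edge n → ESet n
remove H e e' = H e' ∧ not (e' ==ᵉ e)

sameESet : {n : ℕ} → ESet n → ESet n → Bool
sameESet {n} H H' = all (λ e → ⌊ Data.Bool._≟_ (H e) (H' e) ⌋) (edges n)
  where import Data.Bool

δ : {n : ℕ} → VSet n → ESet n
δ U e = U (lo e) xor U (hi e)

single : {n : ℕ} → Fin n → VSet n
single v u = ⌊ u FinP.≟ v ⌋

incident : {n : ℕ} → Fin n → ESet n
incident v e = ⌊ lo e FinP.≟ v ⌋ ∨ ⌊ hi e FinP.≟ v ⌋

nonemptyᵇ : {n : ℕ} → VSet n → Bool
nonemptyᵇ {n} U = any U (allFin n)

properᵇ : {n : ℕ} → VSet n → Bool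
properᵇ {n} U = any (λ v → not (U v)) (allFin n)

subsets : (n : ℕ) → List (VSet n)
subsets zero    = (λ ()) ∷ []
subsets (suc n) = concatMap (λ U → ext false U ∷ ext true U ∷ []) (subsets n)
  where
  ext : Bool → VSet n → VSet (suc n)
  ext b U Fin.zero    = b
  ext b U (Fin.suc i) = U i

Adj : {n : ℕ} → ESet n → Fin n → Fin n → Set
Adj H v w = Σ (Edge _) λ e → H e ≡ true × ((lo e ≡ v × hi e ≡ w) ⊎ (lo e ≡ w × hi e ≡ v))

data Reach {n : ℕ} (H : ESet n) (u : Fin n) : Fin n → Set where
  here : Reach H u u
  step : ∀ {v w} → Reach H u v → Adj H v w → Reach H u w

Connected : {n : ℕ} → ESet n → Set
Connected H = ∀ u v → Reach H u v

-- a spanning tree of V: connected and acyclic (every edge is a bridge,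
-- i.e. lies on no cycle)
IsSpanningTree : {n : ℕ} → ESet n → Set
IsSpanningTree H = Connected H × (∀ e → H e ≡ true → ¬ Connected (remove H e))

-- D is (the edge set of) a spanning tree of the graph obtained from the
-- complete graph by contracting the connected components of (V, G):
-- connected after contraction, and acyclic in the contracted graph
IsContractedST : {n : ℕ} → ESet n → ESet n → Set
IsContractedST G D =
  Connected (G ∪ᵉ D) × (∀ e → D e ≡ true → ¬ Connected (G ∪ᵉ remove D e))

IsMinContractedST : {n : ℕ} → (Edge n → ℚ) → ESet n → ESet n → Set
IsMinContractedST c G D =
  IsContractedST G D × (∀ D' → IsContractedST G D' → c ⟨ D ⟩ ≤ c ⟨ D' ⟩)

oddVerts : {n : ℕ} → ESet n → VSet n
oddVerts X v = oddᵇ (card (X ∩ᵉ incident v))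

IsJoin : {n : ℕ} → VSet n → ESet n → Set
IsJoin T J = ∀ v → oddVerts J v ≡ T v

-- cost between two vertices (0 on the diagonal)
costV : {n : ℕ} → (Edge n → ℚ) → Fin n → Fin n → ℚ
costV c u v = Σₑ (λ e → [ (⌊ lo e FinP.≟ u ⌋ ∧ ⌊ hi e FinP.≟ v ⌋) ∨ (⌊ lo e FinP.≟ v ⌋ ∧ ⌊ hi e FinP.≟ u ⌋) ] * c e)

Metric : {n : ℕ} → (Edge n → ℚ) → Set
Metric c = (∀ e → 0ℚ ≤ c e) × (∀ u v w → costV c u w ≤ costV c u v + costV c v w)

-- The subtour elimination LP for s-t path TSP

module _ {n : ℕ} (s t : Fin n) where

  fval : VSet n → ℚ
  fval U = if U s xor U t then 1ℚ else 2ℚ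

  Feasible : (Edge n → ℚ) → Set
  Feasible x =
    (∀ e → 0ℚ ≤ x e) ×
    (∀ i → x ⟨ δ (single i) ⟩ ≡ fval (single i)) ×
    (∀ U → nonemptyᵇ U ≡ true → properᵇ U ≡ true → fval U ≤ x ⟨ δ U ⟩)

  Optimal : (Edge n → ℚ) → (Edge n → ℚ) → Set
  Optimal c x = Feasible x × (∀ x' → Feasible x' → c ⟨ x ⟩ₗ ≤ c ⟨ x' ⟩ₗ)
    where
    _⟨_⟩ₗ : (Edge n → ℚ) → (Edge n → ℚ) → ℚ
    c ⟨ y ⟩ₗ = Σₑ (λ e → c e * y e)

module _ {n : ℕ} (x : Edge n → ℚ) where

  supp : ESet n
  supp e = 0ℚ <ᵇ x e

  cutE : VSet n → ESet n
  cutE U = δ U ∩ᵉ supp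

  narrowᵇ : VSet n → Bool
  narrowᵇ U = nonemptyᵇ U ∧ properᵇ U ∧ (x ⟨ cutE U ⟩ <ᵇ 2ℚ)

  narrowCuts : List (ESet n)
  narrowCuts = deduplicateᵇ sameESet (map cutE (filterᵇ narrowᵇ (subsets n)))

-- for a tree S with lonely edges L and a cut Q: Q ∈ 𝒬(S) with e = e_S^Q
-- (Q ∩ S = {e}, e ∈ L(S))
lonelyAt : {n : ℕ} → ESet n → ESet n → ESet n → Edge n → Bool
lonelyAt S L Q e = L e ∧ S e ∧ Q e ∧ (card (Q ∩ᵉ S) ℕ.≡ᵇ 1)

-- Q ∈ 𝒬(S) (for Q ∈ 𝒬)
inQS : {n : ℕ} → ESet n → ESet n → ESet n → Bool
inQS {n} S L Q = any (lonelyAt S L Q) (edges n)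

record TreeComb (n m : ℕ) : Set where
  field
    coef   : Fin m → ℚ
    tree   : Fin m → ESet n
    lonely : Fin m → ESet n
open TreeComb public

module _ {n m : ℕ} (x : Edge n → ℚ) (C : TreeComb n m) where

  -- x^Q(e) = Pr(Q ∈ 𝒬(𝒮), e_𝒮^Q = e)
  xQ : ESet n → Edge n → ℚ
  xQ Q e = Σ[ allFin m ] (λ k → coef C k * [ lonelyAt (tree C k) (lonely C k) Q e ])

  IsTreeComb : Set
  IsTreeComb =
    (∀ k → 0ℚ < coef C k) ×
    (Σ[ allFin m ] (coef C) ≡ 1ℚ) ×
    (∀ k → IsSpanningTree (tree C k)) ×
    (∀ k e → tree C k e ≡ true → supp x e ≡ true) ×
    (∀ k e → lonely C k e ≡ true →
       tree C k e ≡ true ×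
       Σ (VSet n) λ U → narrowᵇ x U ≡ true × cutE x U e ≡ true ×
                         card (cutE x U ∩ᵉ tree C k) ≡ 1)

  IsLayeredTree : Fin m → Set
  IsLayeredTree k = ∀ U U' → narrowᵇ x U ≡ true → narrowᵇ x U' ≡ true →
    inQS (tree C k) (lonely C k) (cutE x U) ≡ true →
    x ⟨ cutE x U' ⟩ ≤ x ⟨ cutE x U ⟩ →
    inQS (tree C k) (lonely C k) (cutE x U') ≡ true

  IsLayered : Set
  IsLayered =
    IsTreeComb ×
    (∀ e → Σ[ allFin m ] (λ k → coef C k * [ tree C k e ]) ≡ x e) ×
    (∀ U → narrowᵇ x U ≡ true → xQ (cutE x U) ⟨ cutE x U ⟩ ≡ 2ℚ - x ⟨ cutE x U ⟩) ×
    (∀ k → IsLayeredTree k)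

-- The s-t path of a tree: P is the edge set of S(s,t)
-- (e ∈ S(s,t) iff e ∈ S and e separates s from t in S)

IsTreePath : {n : ℕ} → ESet n → Fin n → Fin n → ESet n → Set
IsTreePath S s t P = ∀ e → (P e ≡ true → S e ≡ true × ¬ Reach (remove S e) s t) ×
                           (S e ≡ true → ¬ Reach (remove S e) s t → P e ≡ true)

module _ {n m : ℕ} (x : Edge n → ℚ) (C : TreeComb n m) (k : Fin m)
         (P : ESet n) (γ : ℚ) where

  private
    S L F : ESet n
    S = tree C k
    L = lonely C k
    F = S ∖ᵉ L
    g : ESet n → ℚ
    g Q = 1ℚ - ½ * x ⟨ Q ⟩ - γ
    small : ESet n → Bool
    small Q = x ⟨ Q ⟩ <ᵇ (2ℚ - 2ℚ * γ)
    evenBig : ESet n → Bool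
    evenBig Q = (1 ℕ.<ᵇ card (Q ∩ᵉ F)) ∧ not (oddᵇ (card (Q ∩ᵉ F)))

  yF : Edge n → ℚ
  yF e = ½ * x e + γ * [ P e ]
       + Σ[ narrowCuts x ] (λ Q → [ small Q ] * (g Q * [ lonelyAt S L Q e ]))
       + Σ[ narrowCuts x ] (λ Q → [ small Q ∧ evenBig Q ] *
                                   (safeDiv (g Q) (2ℚ - x ⟨ Q ⟩) * xQ x C Q e))

joinTarget : {n : ℕ} → ESet n → Fin n → Fin n → VSet n
joinTarget F s t v = oddVerts F v xor (⌊ v FinP.≟ s ⌋ ∨ ⌊ v FinP.≟ t ⌋)

rhsBound : {n : ℕ} → (Edge n → ℚ) → (Edge n → ℚ) → ESet n → ESet n → ℚ
rhsBound x c S L =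
  Σ[ narrowCuts x ] (λ Q → Σₑ (λ e → [ lonelyAt S L Q e ] * ((x ⟨ Q ⟩ - 1ℚ) * c e)))

{-# OPTIONS --safe #-}

-- For a lonely edge e let W e be a side of a narrow cut that S crosses only in e.  Scan the
-- lonely edges by decreasing cost and buy e when some edge of J crosses both W e and the cut
-- of a dearer lonely edge.  The bought edges connect F + J: were U a cut avoiding F, J and all
-- bought edges, take the cheapest lonely e in δ(U); by parity J crosses W e, the crossing edge
-- crosses no dearer cut because e was not bought, and since δ(U) is the symmetric difference
-- of the cuts W g with g ∈ S ∩ δ(U), this edge of J lies in δ(U).
--
-- Layeredness gives y_F = x*/2 on every edge lying in two lonely cuts.  Hence twice the expected
-- number of bought edges among the j dearest ones is at most the sum of their x*(Q) minus the
-- x*-mass of the union of their cuts.  That mass is at least j, since every spanning tree has at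
-- least j edges in the union of j independent cuts.  Abel summation over j turns these cardinality
-- bounds into the cost bound.
module Submission where

open import Defs
open import Data.Nat using (ℕ)
open import Data.Fin using (Fin)
open import Data.Bool using (true)
open import Data.List using (allFin)
open import Data.Product using (_×_)
open import Data.Rational using (ℚ; 0ℚ; 1ℚ; ½; _*_; _≤_; _<_)
open import Relation.Binary.PropositionalEquality using (_≡_; _≢_)

open import Data.Bool using (Bool; false; not; _∧_; _∨_; _xor_; T; if_then_else_)
import Data.Bool as Bool
open import Data.Bool.ListAction using (any)
import Data.Bool.Properties as BoolP
open import Data.Bool.Solver using (module xor-∧-Solver)
open import Data.Empty using (⊥; ⊥-elim)
import Data.Fin as Fin
import Data.Fin.Properties as FinP
open import Data.List using (List; []; _∷_; map; concatMap; mapMaybe; filterᵇ; deduplicateᵇ; length; foldr)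
import Data.List.Properties as ListP
open import Data.List.Membership.Propositional using (_∈_; lose)
import Data.List.Membership.Propositional.Properties as ∈P
open import Data.List.Relation.Binary.Permutation.Propositional using (_↭_; ↭-sym; ↭⇒↭ₛ)
open import Data.List.Relation.Binary.Permutation.Propositional.Properties using (∈-resp-↭)
open import Data.List.Relation.Binary.Permutation.Setoid.Properties using (Unique-resp-↭)
open import Data.List.Relation.Unary.All using (All; []; _∷_)
import Data.List.Relation.Unary.All as All
import Data.List.Relation.Unary.All.Properties as AllP
open import Data.List.Relation.Unary.AllPairs using (AllPairs; []; _∷_)
import Data.List.Relation.Unary.AllPairs as AllPairs
import Data.List.Relation.Unary.AllPairs.Properties as AllPairsP
open import Data.List.Relation.Unary.Any using (here; there)
open import Data.List.Relation.Unary.Sorted.TotalOrder.Properties using (Sorted⇒AllPairs)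
open import Data.List.Relation.Unary.Unique.Propositional using (Unique)
import Data.List.Relation.Unary.Unique.Propositional.Properties as UniqueP
import Data.List.Sort as Sort
open import Data.Maybe using (Maybe; just; nothing)
open import Data.Nat using (zero; suc)
import Data.Nat as ℕ
import Data.Nat.Properties as ℕP
open import Data.Product using (_,_; proj₁; proj₂; ∃; ∃-syntax)
open import Data.Rational using (_+_; _-_; -_)
import Data.Rational as ℚ
import Data.Rational.Properties as ℚP
open import Data.Rational.Solver using (module +-*-Solver)
open import Data.Sum using (_⊎_; inj₁; inj₂)
open import Data.Unit using (tt)
open import Function using (_∘_; case_of_)
open import Relation.Binary.Bundles using (DecTotalOrder)
import Relation.Binary.Construct.Flip.EqAndOrd as Flip
import Relation.Binary.Construct.On as On
open import Relation.Binary.PropositionalEquality using (refl; sym; trans; cong; cong₂; subst; subst₂; setoid; module ≡-Reasoning)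
open import Relation.Nullary using (¬_; Dec; yes; no; contradiction)
open import Relation.Nullary.Decidable using (⌊_⌋; decidable-stable)
open import Relation.Nullary.Decidable.Core using (¬¬-excluded-middle)

private
  variable
    A B : Set
    n : ℕ

-- Booleans

true≢false : {b : Bool} → b ≡ true → b ≡ false → ⊥
true≢false refl ()

∧-elim : ∀ {a b} → a ∧ b ≡ true → a ≡ true × b ≡ true
∧-elim {true} p = refl , p

∧-intro : ∀ {a b} → a ≡ true → b ≡ true → a ∧ b ≡ true
∧-intro refl q = q

∨-elim : ∀ {a b} → a ∨ b ≡ true → a ≡ true ⊎ b ≡ true
∨-elim {true}  p = inj₁ refl
∨-elim {false} p = inj₂ p

∨-introˡ : ∀ {a b} → a ≡ true → a ∨ b ≡ true
∨-introˡ refl = refl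

∨-introʳ : ∀ a {b} → b ≡ true → a ∨ b ≡ true
∨-introʳ a refl = BoolP.∨-zeroʳ a

∨-falseˡ : ∀ a {b} → a ∨ b ≡ false → a ≡ false
∨-falseˡ false _ = refl

∨-falseʳ : ∀ a {b} → a ∨ b ≡ false → b ≡ false
∨-falseʳ false h = h

true-or-false : ∀ b → b ≡ true ⊎ b ≡ false
true-or-false true  = inj₁ refl
true-or-false false = inj₂ refl

T⇒≡ : ∀ {b} → T b → b ≡ true
T⇒≡ {true} _ = refl

≡⇒T : ∀ {b} → b ≡ true → T b
≡⇒T refl = tt

does-true : {P : Set} (d : Dec P) → ⌊ d ⌋ ≡ true → P
does-true (yes p) _ = p

does-intro : {P : Set} (d : Dec P) → P → ⌊ d ⌋ ≡ true
does-intro (yes _) _ = refl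
does-intro (no ¬p) p = contradiction p ¬p

xor-interchange : ∀ a b c d → (a xor b) xor (c xor d) ≡ (a xor c) xor (b xor d)
xor-interchange a b c d = solve 4 (λ a b c d → (a :+ b) :+ (c :+ d) := (a :+ c) :+ (b :+ d)) refl a b c d
  where open xor-∧-Solver

xor-self : ∀ a → a xor a ≡ false
xor-self false = refl
xor-self true  = refl

any-intro : {p : A → Bool} {xs : List A} {a : A} → a ∈ xs → p a ≡ true → any p xs ≡ true
any-intro (here refl)        pa = ∨-introˡ pa
any-intro {p = p} (there {x = x} a∈) pa = ∨-introʳ (p x) (any-intro a∈ pa)

any-elim : {p : A → Bool} (xs : List A) → any p xs ≡ true → ∃[ a ] (a ∈ xs × p a ≡ true)
any-elim {p = p} (x ∷ xs) h with ∨-elim {p x} h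
... | inj₁ px = x , here refl , px
... | inj₂ r with any-elim xs r
... | a , a∈ , pa = a , there a∈ , pa

any-cong : {p q : A → Bool} (xs : List A) → (∀ a → p a ≡ q a) → any p xs ≡ any q xs
any-cong []       h = refl
any-cong (x ∷ xs) h = cong₂ _∨_ (h x) (any-cong xs h)

-- Finite rational sums

0≤[_] : ∀ b → 0ℚ ≤ [ b ]
0≤[ true ]  = ℚP.nonNegative⁻¹ 1ℚ
0≤[ false ] = ℚP.≤-refl

*-monoˡ-≤ : ∀ {r p q} → 0ℚ ≤ r → p ≤ q → r * p ≤ r * q
*-monoˡ-≤ {r} 0≤r = ℚP.*-monoˡ-≤-nonNeg r {{ℚ.nonNegative 0≤r}}

*-monoʳ-≤ : ∀ {r p q} → 0ℚ ≤ r → p ≤ q → p * r ≤ q * r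
*-monoʳ-≤ {r} 0≤r = ℚP.*-monoʳ-≤-nonNeg r {{ℚ.nonNegative 0≤r}}

0≤* : ∀ {p q} → 0ℚ ≤ p → 0ℚ ≤ q → 0ℚ ≤ p * q
0≤* {p} {q} 0≤p 0≤q = subst (_≤ p * q) (ℚP.*-zeroʳ p) (*-monoˡ-≤ 0≤p 0≤q)

p≤q⇒0≤q-p : ∀ {p q} → p ≤ q → 0ℚ ≤ q - p
p≤q⇒0≤q-p {p} {q} p≤q = subst (_≤ q - p) (ℚP.+-inverseʳ p) (ℚP.+-monoˡ-≤ (- p) p≤q)

Σ-cong∈ : (xs : List A) {f g : A → ℚ} → (∀ {a} → a ∈ xs → f a ≡ g a) → Σ[ xs ] f ≡ Σ[ xs ] g
Σ-cong∈ []       h = refl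
Σ-cong∈ (x ∷ xs) h = cong₂ _+_ (h (here refl)) (Σ-cong∈ xs (h ∘ there))

Σ-cong : (xs : List A) {f g : A → ℚ} → (∀ a → f a ≡ g a) → Σ[ xs ] f ≡ Σ[ xs ] g
Σ-cong xs h = Σ-cong∈ xs (λ {a} _ → h a)

Σ-mono∈ : (xs : List A) {f g : A → ℚ} → (∀ {a} → a ∈ xs → f a ≤ g a) → Σ[ xs ] f ≤ Σ[ xs ] g
Σ-mono∈ []       h = ℚP.≤-refl
Σ-mono∈ (x ∷ xs) h = ℚP.+-mono-≤ (h (here refl)) (Σ-mono∈ xs (h ∘ there))

Σ-mono : (xs : List A) {f g : A → ℚ} → (∀ a → f a ≤ g a) → Σ[ xs ] f ≤ Σ[ xs ] g
Σ-mono xs h = Σ-mono∈ xs (λ {a} _ → h a)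

Σ-0 : (xs : List A) → Σ[ xs ] (λ _ → 0ℚ) ≡ 0ℚ
Σ-0 []       = refl
Σ-0 (x ∷ xs) = trans (ℚP.+-identityˡ _) (Σ-0 xs)

Σ-zero : (xs : List A) {f : A → ℚ} → (∀ {a} → a ∈ xs → f a ≡ 0ℚ) → Σ[ xs ] f ≡ 0ℚ
Σ-zero xs h = trans (Σ-cong∈ xs h) (Σ-0 xs)

Σ-nonNeg : (xs : List A) {f : A → ℚ} → (∀ {a} → a ∈ xs → 0ℚ ≤ f a) → 0ℚ ≤ Σ[ xs ] f
Σ-nonNeg xs {f} h = subst (_≤ Σ[ xs ] f) (Σ-0 xs) (Σ-mono∈ xs h)

Σ-+ : (xs : List A) (f g : A → ℚ) → Σ[ xs ] (λ a → f a + g a) ≡ Σ[ xs ] f + Σ[ xs ] g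
Σ-+ []       f g = refl
Σ-+ (x ∷ xs) f g = trans (cong (f x + g x +_) (Σ-+ xs f g))
  (solve 4 (λ a b c d → (a :+ b) :+ (c :+ d) := (a :+ c) :+ (b :+ d)) refl (f x) (g x) _ _)
  where open +-*-Solver

Σ-*ˡ : (xs : List A) (q : ℚ) (f : A → ℚ) → Σ[ xs ] (λ a → q * f a) ≡ q * Σ[ xs ] f
Σ-*ˡ []       q f = sym (ℚP.*-zeroʳ q)
Σ-*ˡ (x ∷ xs) q f = trans (cong (q * f x +_) (Σ-*ˡ xs q f)) (sym (ℚP.*-distribˡ-+ q (f x) _))

Σ-*ʳ : (xs : List A) (q : ℚ) (f : A → ℚ) → Σ[ xs ] (λ a → f a * q) ≡ Σ[ xs ] f * q
Σ-*ʳ xs q f = trans (Σ-cong xs (λ a → ℚP.*-comm (f a) q)) (trans (Σ-*ˡ xs q f) (ℚP.*-comm q _))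

Σ-swap : (xs : List A) (ys : List B) (f : A → B → ℚ) →
  Σ[ xs ] (λ a → Σ[ ys ] (λ b → f a b)) ≡ Σ[ ys ] (λ b → Σ[ xs ] (λ a → f a b))
Σ-swap []       ys f = sym (Σ-0 ys)
Σ-swap (x ∷ xs) ys f = trans (cong (Σ[ ys ] (f x) +_) (Σ-swap xs ys f))
  (sym (Σ-+ ys (f x) (λ b → Σ[ xs ] (λ a → f a b))))

term≤Σ : {xs : List A} {f : A → ℚ} {a : A} → (∀ {b} → b ∈ xs → 0ℚ ≤ f b) → a ∈ xs → f a ≤ Σ[ xs ] f
term≤Σ {xs = x ∷ xs} {f} h (here refl) =
  subst (_≤ f x + Σ[ xs ] f) (ℚP.+-identityʳ (f x)) (ℚP.+-monoʳ-≤ (f x) (Σ-nonNeg xs (h ∘ there)))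
term≤Σ {xs = x ∷ xs} {f} {a} h (there a∈) =
  subst (_≤ f x + Σ[ xs ] f) (ℚP.+-identityˡ (f a)) (ℚP.+-mono-≤ (h (here refl)) (term≤Σ (h ∘ there) a∈))

-- Linearity of expectation: `μ` weights the outcomes and `h b` is the vector drawn in outcome `b`.
-- It serves both the random tree and the random join.
Σ-expectation : (xs : List A) (ys : List B) (μ : B → ℚ) (h : B → A → ℚ) (w : A → ℚ) →
  Σ[ ys ] (λ b → μ b * Σ[ xs ] (λ a → h b a * w a)) ≡ Σ[ xs ] (λ a → Σ[ ys ] (λ b → μ b * h b a) * w a)
Σ-expectation xs ys μ h w = begin
  Σ[ ys ] (λ b → μ b * Σ[ xs ] (λ a → h b a * w a))
    ≡⟨ Σ-cong ys (λ b → sym (Σ-*ˡ xs (μ b) (λ a → h b a * w a))) ⟩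
  Σ[ ys ] (λ b → Σ[ xs ] (λ a → μ b * (h b a * w a)))
    ≡⟨ Σ-swap ys xs (λ b a → μ b * (h b a * w a)) ⟩
  Σ[ xs ] (λ a → Σ[ ys ] (λ b → μ b * (h b a * w a)))
    ≡⟨ Σ-cong xs (λ a → Σ-cong ys (λ b → sym (ℚP.*-assoc (μ b) (h b a) (w a)))) ⟩
  Σ[ xs ] (λ a → Σ[ ys ] (λ b → μ b * h b a * w a))
    ≡⟨ Σ-cong xs (λ a → Σ-*ʳ ys (w a) (λ b → μ b * h b a)) ⟩
  Σ[ xs ] (λ a → Σ[ ys ] (λ b → μ b * h b a) * w a) ∎
  where open ≡-Reasoning

-- Edges

edge-ext : {e e' : Edge n} → lo e ≡ lo e' → hi e ≡ hi e' → e ≡ e'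
edge-ext {e = edge i j p} {edge .i .j q} refl refl = cong (edge i j) (FinP.<-irrelevant p q)

==ᵉ-refl : (e : Edge n) → (e ==ᵉ e) ≡ true
==ᵉ-refl e = ∧-intro (does-intro (lo e FinP.≟ lo e) refl) (does-intro (hi e FinP.≟ hi e) refl)

==ᵉ⇒≡ : (e e' : Edge n) → (e ==ᵉ e') ≡ true → e ≡ e'
==ᵉ⇒≡ e e' h with ∧-elim {⌊ lo e FinP.≟ lo e' ⌋} h
... | p , q = edge-ext (does-true (lo e FinP.≟ lo e') p) (does-true (hi e FinP.≟ hi e') q)

∈-mapMaybe⁺ : {f : A → Maybe B} {xs : List A} {a : A} {b : B} → a ∈ xs → f a ≡ just b → b ∈ mapMaybe f xs
∈-mapMaybe⁺ {f = f} {x ∷ xs} (here refl) fa rewrite fa = here refl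
∈-mapMaybe⁺ {f = f} {x ∷ xs} (there a∈) fa with f x
... | just _  = there (∈-mapMaybe⁺ a∈ fa)
... | nothing = ∈-mapMaybe⁺ a∈ fa

∈-mapMaybe⁻ : {f : A → Maybe B} (xs : List A) {b : B} → b ∈ mapMaybe f xs → ∃[ a ] (a ∈ xs × f a ≡ just b)
∈-mapMaybe⁻ {f = f} (x ∷ xs) b∈ with f x in eq
∈-mapMaybe⁻ (x ∷ xs) (here refl) | just _ = x , here refl , eq
∈-mapMaybe⁻ (x ∷ xs) (there b∈) | just _ with ∈-mapMaybe⁻ xs b∈
... | a , a∈ , q = a , there a∈ , q
∈-mapMaybe⁻ (x ∷ xs) b∈ | nothing with ∈-mapMaybe⁻ xs b∈
... | a , a∈ , q = a , there a∈ , q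

mapMaybe-unique : {f : A → Maybe B} → (∀ {a a' b} → f a ≡ just b → f a' ≡ just b → a ≡ a') →
  {xs : List A} → Unique xs → Unique (mapMaybe f xs)
mapMaybe-unique inj [] = []
mapMaybe-unique {f = f} inj {x ∷ xs} (x∉ ∷ u) with f x in eq
... | nothing = mapMaybe-unique inj u
... | just b  = All.tabulate fresh ∷ mapMaybe-unique inj u
  where
  fresh : ∀ {b'} → b' ∈ mapMaybe f xs → b ≢ b'
  fresh b'∈ refl with ∈-mapMaybe⁻ xs b'∈
  ... | a , a∈ , q = All.lookup x∉ a∈ (inj eq q)

-- The local function in the definition of `edges` has no name outside it; unification recovers it.
record EdgesForm (n : ℕ) : Set where
  field
    mk : Fin n → Fin n → Maybe (Edge n)
    edges≡ : edges n ≡ concatMap (λ i → mapMaybe (mk i) (allFin n)) (allFin n)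

edgesForm : ∀ n → EdgesForm n
edgesForm n = record { mk = _ ; edges≡ = refl }

module _ {n : ℕ} where
  open EdgesForm (edgesForm n)

  mk-just : ∀ (e : Edge n) → mk (lo e) (hi e) ≡ just e
  mk-just e with lo e FinP.<? hi e
  ... | yes p = cong just (edge-ext refl refl)
  ... | no ¬p = contradiction (lo<hi e) ¬p

  mk-lohi : ∀ i j {e} → mk i j ≡ just e → lo e ≡ i × hi e ≡ j
  mk-lohi i j h with i FinP.<? j
  mk-lohi i j refl | yes p = refl , refl
  mk-lohi i j () | no _

  ∈-edges : (e : Edge n) → e ∈ edges n
  ∈-edges e = ∈P.∈-concatMap⁺ (λ i → mapMaybe (mk i) (allFin n))
    (lose (∈P.∈-allFin (lo e)) (∈-mapMaybe⁺ (∈P.∈-allFin (hi e)) (mk-just e)))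

  -- The list is grouped by lower endpoint. Inside a group the upper endpoint can be read off the
  -- edge, and across groups the lower endpoint can, so nothing repeats.
  edges-unique : Unique (edges n)
  edges-unique = UniqueP.concat⁺
    (AllP.map⁺ (All.tabulate λ {i} _ →
      mapMaybe-unique (λ {j} {j'} p q → trans (sym (proj₂ (mk-lohi i j p))) (proj₂ (mk-lohi i j' q))) (UniqueP.allFin⁺ n)))
    (AllPairsP.map⁺ (AllPairs.map disjoint (UniqueP.allFin⁺ n)))
    where
    disjoint : ∀ {i i'} → i ≢ i' → ∀ {e} → ¬ (e ∈ mapMaybe (mk i) (allFin n) × e ∈ mapMaybe (mk i') (allFin n))
    disjoint {i} {i'} i≢i' (p , q) with ∈-mapMaybe⁻ (allFin n) p | ∈-mapMaybe⁻ (allFin n) q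
    ... | j , _ , r | j' , _ , r' = i≢i' (trans (sym (proj₁ (mk-lohi i j r))) (proj₁ (mk-lohi i' j' r')))

-- Once `e` has been met, uniqueness of the enumeration makes all later terms vanish. Nonnegativity
-- of `c` covers the list exhausted without meeting `e`.
Σ-indicator≤ : (c : Edge n → ℚ) → (∀ e → 0ℚ ≤ c e) → (e : Edge n) → Σₑ (λ g → [ g ==ᵉ e ] * c g) ≤ c e
Σ-indicator≤ {n} c 0≤c e = go (edges n) edges-unique
  where
  go : (xs : List (Edge n)) → Unique xs → Σ[ xs ] (λ g → [ g ==ᵉ e ] * c g) ≤ c e
  go [] _ = 0≤c e
  go (x ∷ xs) (x∉ ∷ u) with x ==ᵉ e in eq
  ... | false = subst (_≤ c e) (sym (trans (cong (_+ Σ[ xs ] _) (ℚP.*-zeroˡ (c x))) (ℚP.+-identityˡ _))) (go xs u)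
  ... | true with ==ᵉ⇒≡ x e eq
  ... | refl = ℚP.≤-reflexive (trans (cong (1ℚ * c x +_) (Σ-zero xs other))
                 (trans (ℚP.+-identityʳ _) (ℚP.*-identityˡ (c x))))
    where
    other : ∀ {g} → g ∈ xs → [ g ==ᵉ x ] * c g ≡ 0ℚ
    other {g} g∈ with g ==ᵉ x in eq'
    ... | false = ℚP.*-zeroˡ (c g)
    ... | true  = contradiction (sym (==ᵉ⇒≡ g x eq')) (All.lookup x∉ g∈)

-- Filtered edge lists and cardinalities

∈-filterᵇ⁺ : (p : A → Bool) {xs : List A} {a : A} → a ∈ xs → p a ≡ true → a ∈ filterᵇ p xs
∈-filterᵇ⁺ p a∈ pa = ∈P.∈-filter⁺ (BoolP.T? ∘ p) a∈ (≡⇒T pa)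

∈-filterᵇ⁻ : (p : A → Bool) {xs : List A} {a : A} → a ∈ filterᵇ p xs → a ∈ xs × p a ≡ true
∈-filterᵇ⁻ p {xs} a∈ with ∈P.∈-filter⁻ (BoolP.T? ∘ p) {xs = xs} a∈
... | q , r = q , T⇒≡ r

card-1⇒≡ : {H : ESet n} → card H ≡ 1 → ∀ {e e'} → H e ≡ true → H e' ≡ true → e ≡ e'
card-1⇒≡ {n} {H} h {e} {e'} He He' =
  singleton h (∈-filterᵇ⁺ H (∈-edges e) He) (∈-filterᵇ⁺ H (∈-edges e') He')
  where
  singleton : {xs : List (Edge n)} → length xs ≡ 1 → ∀ {a b} → a ∈ xs → b ∈ xs → a ≡ b
  singleton {_ ∷ []} _ (here refl) (here refl) = refl

card-suc⇒∃ : {H : ESet n} {k : ℕ} → card H ≡ suc k → ∃[ e ] H e ≡ true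
card-suc⇒∃ {n} {H} h = go h (λ a∈ → proj₂ (∈-filterᵇ⁻ H {edges n} a∈))
  where
  go : ∀ {xs : List (Edge n)} {k} → length xs ≡ suc k → (∀ {a} → a ∈ xs → H a ≡ true) → ∃[ e ] H e ≡ true
  go {x ∷ _} _ g = x , g (here refl)

card-cong : {H H' : ESet n} → (∀ e → H e ≡ H' e) → card H ≡ card H'
card-cong {n} {H} {H'} h = go (edges n)
  where
  go : ∀ xs → length (filterᵇ H xs) ≡ length (filterᵇ H' xs)
  go [] = refl
  go (x ∷ xs) with H x | H' x | h x
  ... | true  | _ | refl = cong suc (go xs)
  ... | false | _ | refl = go xs

-- Cuts and connectivity

infixl 6 _⊻_
_⊻_ : VSet n → VSet n → VSet n
(U ⊻ U') v = U v xor U' v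

δ-⊻ : (U U' : VSet n) (e : Edge n) → δ (U ⊻ U') e ≡ δ U e xor δ U' e
δ-⊻ U U' e = xor-interchange (U (lo e)) (U' (lo e)) (U (hi e)) (U' (hi e))

δ-adj : (U : VSet n) (e : Edge n) {v w : Fin n} → (lo e ≡ v × hi e ≡ w) ⊎ (lo e ≡ w × hi e ≡ v) →
  δ U e ≡ U v xor U w
δ-adj U e (inj₁ (refl , refl)) = refl
δ-adj U e (inj₂ (refl , refl)) = BoolP.xor-comm (U (lo e)) (U (hi e))

-- Induction on the walk: either its initial part already leaves the side of `u`, or its last edge
-- does.
reach-cross : {H : ESet n} (U : VSet n) {u v : Fin n} → Reach H u v → U u xor U v ≡ true →
  ∃[ e ] (H e ≡ true × δ U e ≡ true)
reach-cross U {u} here h = ⊥-elim (true≢false h (xor-self (U u)))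
reach-cross U {u} (step {v} {w} r (e , He , inc)) h with U u xor U v in eq
... | true  = reach-cross U r eq
... | false = e , He , trans (δ-adj U e inc) (trans (telescope (U u) (U v) (U w) eq) h)
  where
  telescope : ∀ a b c → a xor b ≡ false → b xor c ≡ a xor c
  telescope true  true  c _ = refl
  telescope false false c _ = refl

connected-constant : {H : ESet n} → Connected H → (U : VSet n) → (∀ e → H e ≡ true → δ U e ≡ false) →
  ∀ u v → U u xor U v ≡ false
connected-constant H-conn U h u v with U u xor U v in eq
... | false = refl
... | true with reach-cross U (H-conn u v) eq
... | e , He , δe = ⊥-elim (true≢false δe (h e He))

reach-mono : {H H' : ESet n} → (∀ e → H e ≡ true → H' e ≡ true) → ∀ {u v} → Reach H u v → Reach H' u v
reach-mono H⊆H' here = here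
reach-mono H⊆H' (step r (e , He , inc)) = step (reach-mono H⊆H' r) (e , H⊆H' e He , inc)

¬¬-map : {P Q : Set} → (P → Q) → ¬ ¬ P → ¬ ¬ Q
¬¬-map f ¬¬p ¬q = ¬¬p (¬q ∘ f)

¬¬-Π : {P : Fin n → Set} → (∀ i → ¬ ¬ P i) → ¬ ¬ (∀ i → P i)
¬¬-Π {zero}  h k = k λ ()
¬¬-Π {suc n} h k = h Fin.zero λ p₀ → ¬¬-Π (h ∘ Fin.suc) λ ps → k λ { Fin.zero → p₀ ; (Fin.suc i) → ps i }

-- The set reachable from `u` is a side of a cut that `H` avoids, so it contains every vertex.
-- Reachability is decided by excluded middle under a double negation, which is harmless because the
-- final goal is a decidable inequality.
¬¬-connected : {H : ESet n} →
  (∀ U → (∀ e → H e ≡ true → δ U e ≡ false) → ∀ u v → U u xor U v ≡ false) → ¬ ¬ Connected H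
¬¬-connected {n} {H} const = ¬¬-map connect (¬¬-Π λ u → ¬¬-Π λ v → ¬¬-excluded-middle)
  where
  connect : (∀ u v → Dec (Reach H u v)) → Connected H
  connect reach? u v = does-true (reach? u v) (agree (reach? u u) (const comp closed u v))
    where
    comp : VSet n
    comp w = ⌊ reach? u w ⌋
    -- By `here` the decision at `u` itself must be `yes`, and constancy of `comp` transports this
    -- to `v`.
    agree : (d : Dec (Reach H u u)) → ⌊ d ⌋ xor comp v ≡ false → comp v ≡ true
    agree (yes _)    h = trans (sym (BoolP.not-involutive (comp v))) (cong not h)
    agree (no ¬here) _ = contradiction here ¬here
    closed : ∀ e → H e ≡ true → δ comp e ≡ false
    closed e He with reach? u (lo e) | reach? u (hi e)
    ... | yes _ | yes _ = refl
    ... | no _  | no _  = refl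
    ... | yes r | no ¬r = contradiction (step r (e , He , inj₁ (refl , refl))) ¬r
    ... | no ¬r | yes r = contradiction (step r (e , He , inj₂ (refl , refl))) ¬r

-- Parity

⊕[_]_ : List A → (A → Bool) → Bool
⊕[ xs ] f = foldr _xor_ false (map f xs)

⊕-cong : (xs : List A) {f g : A → Bool} → (∀ a → f a ≡ g a) → ⊕[ xs ] f ≡ ⊕[ xs ] g
⊕-cong []       h = refl
⊕-cong (x ∷ xs) h = cong₂ _xor_ (h x) (⊕-cong xs h)

⊕-false : (xs : List A) → ⊕[ xs ] (λ _ → false) ≡ false
⊕-false []       = refl
⊕-false (x ∷ xs) = ⊕-false xs

⊕-xor : (xs : List A) (f g : A → Bool) → ⊕[ xs ] (λ a → f a xor g a) ≡ (⊕[ xs ] f) xor (⊕[ xs ] g)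
⊕-xor []       f g = refl
⊕-xor (x ∷ xs) f g = trans (cong ((f x xor g x) xor_) (⊕-xor xs f g)) (xor-interchange (f x) (g x) _ _)

⊕-∧ˡ : (xs : List A) (b : Bool) (f : A → Bool) → ⊕[ xs ] (λ a → b ∧ f a) ≡ b ∧ (⊕[ xs ] f)
⊕-∧ˡ xs true  f = refl
⊕-∧ˡ xs false f = ⊕-false xs

⊕-swap : (xs : List A) (ys : List B) (f : A → B → Bool) →
  ⊕[ xs ] (λ a → ⊕[ ys ] (λ b → f a b)) ≡ ⊕[ ys ] (λ b → ⊕[ xs ] (λ a → f a b))
⊕-swap []       ys f = sym (⊕-false ys)
⊕-swap (x ∷ xs) ys f = trans (cong ((⊕[ ys ] (f x)) xor_) (⊕-swap xs ys f))
  (sym (⊕-xor ys (f x) (λ b → ⊕[ xs ] (λ a → f a b))))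

⊕-pick : (U : VSet n) (a : Fin n) → ⊕[ allFin n ] (λ v → U v ∧ ⌊ a FinP.≟ v ⌋) ≡ U a
⊕-pick {n} U a = present (allFin n) (UniqueP.allFin⁺ n) (∈P.∈-allFin a)
  where
  absent : (xs : List (Fin n)) → All (a ≢_) xs → ⊕[ xs ] (λ v → U v ∧ ⌊ a FinP.≟ v ⌋) ≡ false
  absent [] [] = refl
  absent (x ∷ xs) (a≢x ∷ r) with a FinP.≟ x
  ... | yes a≡x = contradiction a≡x a≢x
  ... | no _    = trans (cong (_xor _) (BoolP.∧-zeroʳ (U x))) (absent xs r)
  present : (xs : List (Fin n)) → Unique xs → a ∈ xs → ⊕[ xs ] (λ v → U v ∧ ⌊ a FinP.≟ v ⌋) ≡ U a
  present (x ∷ xs) (x∉ ∷ u) a∈ with a FinP.≟ x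
  present (x ∷ xs) (x∉ ∷ u) a∈ | yes refl =
    trans (cong₂ _xor_ (BoolP.∧-identityʳ (U a)) (absent xs x∉)) (BoolP.xor-identityʳ (U a))
  present (x ∷ xs) (x∉ ∷ u) (here a≡x) | no a≢x = contradiction a≡x a≢x
  present (x ∷ xs) (x∉ ∷ u) (there a∈) | no _ =
    trans (cong (_xor _) (BoolP.∧-zeroʳ (U x))) (present xs u a∈)

oddᵇ-card : (H : ESet n) → oddᵇ (card H) ≡ ⊕[ edges n ] H
oddᵇ-card {n} H = go (edges n)
  where
  go : ∀ xs → oddᵇ (length (filterᵇ H xs)) ≡ ⊕[ xs ] H
  go [] = refl
  go (x ∷ xs) with H x
  ... | true  = cong not (go xs)
  ... | false = go xs

distinct-∨-xor : (a b v : Fin n) → a ≢ b → ⌊ a FinP.≟ v ⌋ ∨ ⌊ b FinP.≟ v ⌋ ≡ ⌊ a FinP.≟ v ⌋ xor ⌊ b FinP.≟ v ⌋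
distinct-∨-xor a b v a≢b with a FinP.≟ v | b FinP.≟ v
... | yes refl | yes refl = contradiction refl a≢b
... | yes _    | no _     = refl
... | no _     | _        = refl

⊕-pair : (U : VSet n) (a b : Fin n) → a ≢ b →
  ⊕[ allFin n ] (λ v → U v ∧ (⌊ a FinP.≟ v ⌋ ∨ ⌊ b FinP.≟ v ⌋)) ≡ U a xor U b
⊕-pair {n} U a b a≢b = begin
  ⊕[ allFin n ] (λ v → U v ∧ (⌊ a FinP.≟ v ⌋ ∨ ⌊ b FinP.≟ v ⌋))
    ≡⟨ ⊕-cong (allFin n) (λ v → trans (cong (U v ∧_) (distinct-∨-xor a b v a≢b))
                                      (BoolP.∧-distribˡ-xor (U v) ⌊ a FinP.≟ v ⌋ ⌊ b FinP.≟ v ⌋)) ⟩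
  ⊕[ allFin n ] (λ v → (U v ∧ ⌊ a FinP.≟ v ⌋) xor (U v ∧ ⌊ b FinP.≟ v ⌋))
    ≡⟨ ⊕-xor (allFin n) _ _ ⟩
  (⊕[ allFin n ] (λ v → U v ∧ ⌊ a FinP.≟ v ⌋)) xor (⊕[ allFin n ] (λ v → U v ∧ ⌊ b FinP.≟ v ⌋))
    ≡⟨ cong₂ _xor_ (⊕-pick U a) (⊕-pick U b) ⟩
  U a xor U b ∎
  where open ≡-Reasoning

-- Double counting of incidences modulo 2: an edge with both ends in `U` counts twice and cancels,
-- so exactly the edges of the cut survive.
handshake : (H : ESet n) (U : VSet n) → ⊕[ allFin n ] (λ v → U v ∧ oddVerts H v) ≡ oddᵇ (card (H ∩ᵉ δ U))
handshake {n} H U = begin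
  ⊕[ allFin n ] (λ v → U v ∧ oddVerts H v)
    ≡⟨ ⊕-cong (allFin n) (λ v → trans (cong (U v ∧_) (oddᵇ-card (H ∩ᵉ incident v)))
         (sym (⊕-∧ˡ (edges n) (U v) (H ∩ᵉ incident v)))) ⟩
  ⊕[ allFin n ] (λ v → ⊕[ edges n ] (λ e → U v ∧ (H e ∧ incident v e)))
    ≡⟨ ⊕-swap (allFin n) (edges n) _ ⟩
  ⊕[ edges n ] (λ e → ⊕[ allFin n ] (λ v → U v ∧ (H e ∧ incident v e)))
    ≡⟨ ⊕-cong (edges n) (λ e → trans (⊕-cong (allFin n) (λ v → swap∧ (U v) (H e) (incident v e)))
         (trans (⊕-∧ˡ (allFin n) (H e) (λ v → U v ∧ incident v e))
                (cong (H e ∧_) (⊕-pair U (lo e) (hi e) (FinP.<⇒≢ (lo<hi e)))))) ⟩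
  ⊕[ edges n ] (H ∩ᵉ δ U)
    ≡⟨ sym (oddᵇ-card (H ∩ᵉ δ U)) ⟩
  oddᵇ (card (H ∩ᵉ δ U)) ∎
  where
  open ≡-Reasoning
  swap∧ : ∀ a b c → a ∧ (b ∧ c) ≡ b ∧ (a ∧ c)
  swap∧ true  b c = refl
  swap∧ false b c = sym (BoolP.∧-zeroʳ b)

odd⇒∃ : {H : ESet n} → oddᵇ (card H) ≡ true → ∃[ e ] H e ≡ true
odd⇒∃ {H = H} h with card H in eq
... | suc k = card-suc⇒∃ eq

≟-sym : (a b : Fin n) → ⌊ a FinP.≟ b ⌋ ≡ ⌊ b FinP.≟ a ⌋
≟-sym a b with a FinP.≟ b | b FinP.≟ a
... | yes _   | yes _   = refl
... | no _    | no _    = refl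
... | yes a≡b | no b≢a  = contradiction (sym a≡b) b≢a
... | no a≢b  | yes b≡a = contradiction (sym b≡a) a≢b

-- By `handshake`, the number of edges of `J` in the cut has the parity of the number of edges of
-- `F` in it, which is zero, plus one because `U` separates `s` from `t`. Distinctness of `s` and
-- `t` lets the disjunction in `joinTarget` act as a symmetric difference.
join-crosses : {s t : Fin n} → s ≢ t → {F J : ESet n} → IsJoin (joinTarget F s t) J →
  (U : VSet n) → U s xor U t ≡ true → (∀ e → F e ≡ true → δ U e ≡ false) →
  ∃[ e ] (J e ≡ true × δ U e ≡ true)
join-crosses {n} {s} {t} s≢t {F} {J} join U sep F-avoids with odd⇒∃ {H = J ∩ᵉ δ U} odd
  where
  open ≡-Reasoning
  st : Fin n → Bool
  st v = ⌊ v FinP.≟ s ⌋ ∨ ⌊ v FinP.≟ t ⌋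
  F-even : oddᵇ (card (F ∩ᵉ δ U)) ≡ false
  F-even with oddᵇ (card (F ∩ᵉ δ U)) in eq
  ... | false = refl
  ... | true with odd⇒∃ {H = F ∩ᵉ δ U} eq
  ... | e , h with ∧-elim {F e} h
  ... | Fe , δe = ⊥-elim (true≢false δe (F-avoids e Fe))
  odd : oddᵇ (card (J ∩ᵉ δ U)) ≡ true
  odd = begin
    oddᵇ (card (J ∩ᵉ δ U)) ≡⟨ sym (handshake J U) ⟩
    ⊕[ allFin n ] (λ v → U v ∧ oddVerts J v)
      ≡⟨ ⊕-cong (allFin n) (λ v → trans (cong (U v ∧_) (join v)) (BoolP.∧-distribˡ-xor (U v) (oddVerts F v) (st v))) ⟩
    ⊕[ allFin n ] (λ v → (U v ∧ oddVerts F v) xor (U v ∧ st v)) ≡⟨ ⊕-xor (allFin n) _ _ ⟩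
    (⊕[ allFin n ] (λ v → U v ∧ oddVerts F v)) xor (⊕[ allFin n ] (λ v → U v ∧ st v))
      ≡⟨ cong₂ _xor_ (trans (handshake F U) F-even)
           (trans (⊕-cong (allFin n) (λ v → cong (U v ∧_) (cong₂ _∨_ (≟-sym v s) (≟-sym v t)))) (⊕-pair U s t s≢t)) ⟩
    U s xor U t ≡⟨ sep ⟩
    true ∎
... | e , h = e , ∧-elim {J e} h

-- Fundamental cuts

IsFundamental : ESet n → VSet n → Edge n → Set
IsFundamental S U e = S e ≡ true × δ U e ≡ true × (∀ g → S g ≡ true → δ U g ≡ true → g ≡ e)

-- The length as a rational number, written as a sum so that it combines with the other sums.
#_ : List A → ℚ
# xs = Σ[ xs ] (λ _ → 1ℚ)

-- Each cut misses the marker edge of the other. When every cut contains its own marker, this makes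
-- the cuts linearly independent over the two-element field.
Private : VSet n × Edge n → VSet n × Edge n → Set
Private (U , e) (U' , e') = δ U e' ≡ false × δ U' e ≡ false

coveredBy : List (VSet n × Edge n) → ESet n
coveredBy ps f = any (λ p → δ (proj₁ p) f) ps

-- Pointwise inequality for one elimination step in `rank`: `a` says that the edge is the pivot, `h`
-- that it is in `H`, and `r` and `b` that it is covered after and before the reduction.
split-indicator : ∀ a h r b → (a ≡ true → h ≡ true × b ≡ true × r ≡ false) → (r ≡ true → b ≡ true) →
  [ a ] + [ h ] * [ r ] ≤ [ h ] * [ b ]
split-indicator true h r b p q with p refl
... | refl , refl , refl = ℚP.≤-refl
split-indicator false h true b p q with q refl
... | refl = ℚP.≤-reflexive (ℚP.+-identityˡ _)
split-indicator false h false b p q =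
  subst (_≤ [ h ] * [ b ]) (sym (ℚP.+-identityˡ _)) (*-monoˡ-≤ 0≤[ h ] 0≤[ b ])

-- Gaussian elimination: pick an edge f of H in the first cut and xor that cut into every
-- other cut containing f; the private edges stay private and f is no longer covered.
rank : {H : ESet n} → Connected H → (ps : List (VSet n × Edge n)) →
  All (λ (U , e) → δ U e ≡ true) ps → AllPairs Private ps →
  # ps ≤ Σₑ (λ f → [ H f ] * [ coveredBy ps f ])
rank {n} {H} H-conn ps = go (length ps) ps refl
  where
  -- Recursion on the length, since the reduced list of cuts is not a structural part of the given
  -- one.
  go : ∀ k (ps : List (VSet n × Edge n)) → length ps ≡ k →
    All (λ (U , e) → δ U e ≡ true) ps → AllPairs Private ps →
    # ps ≤ Σₑ (λ f → [ H f ] * [ coveredBy ps f ])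
  go zero [] _ _ _ = Σ-nonNeg (edges n) (λ {f} _ → 0≤* 0≤[ H f ] ℚP.≤-refl)
  go (suc k) ((U , e) ∷ ps) len (Ue ∷ own) (priv ∷ privs) with reach-cross U (H-conn (lo e) (hi e)) Ue
  ... | f , Hf , Uf = begin
    1ℚ + # ps ≡⟨ cong (1ℚ +_) (sym #reduced) ⟩
    1ℚ + # reduced ≤⟨ ℚP.+-mono-≤ one (go k reduced len' (own' own priv) (privs' privs priv)) ⟩
    Σₑ (λ g → [ g ==ᵉ f ]) + Σₑ (λ g → [ H g ] * [ coveredBy reduced g ])
      ≡⟨ sym (Σ-+ (edges n) _ _) ⟩
    Σₑ (λ g → [ g ==ᵉ f ] + [ H g ] * [ coveredBy reduced g ]) ≤⟨ Σ-mono (edges n) pointwise ⟩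
    Σₑ (λ g → [ H g ] * [ coveredBy ((U , e) ∷ ps) g ]) ∎
    where
    open ℚP.≤-Reasoning
    reduce : VSet n → VSet n
    reduce U' = if δ U' f then U' ⊻ U else U'
    reduceₚ : VSet n × Edge n → VSet n × Edge n
    reduceₚ (U' , e') = reduce U' , e'
    reduced : List (VSet n × Edge n)
    reduced = map reduceₚ ps
    #reduced : # reduced ≡ # ps
    #reduced = cong sumℚ (sym (ListP.map-∘ ps))
    len' : length reduced ≡ k
    len' = trans (ListP.length-map reduceₚ ps) (ℕP.suc-injective len)
    one : 1ℚ ≤ Σₑ (λ g → [ g ==ᵉ f ])
    one = subst (λ b → [ b ] ≤ Σₑ (λ g → [ g ==ᵉ f ])) (==ᵉ-refl f)
            (term≤Σ {f = λ g → [ g ==ᵉ f ]} (λ {g} _ → 0≤[ g ==ᵉ f ]) (∈-edges f))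
    reduce-off : ∀ U' g → δ U g ≡ false → δ (reduce U') g ≡ δ U' g
    reduce-off U' g h with δ U' f
    ... | false = refl
    ... | true  = trans (δ-⊻ U' U g) (trans (cong (δ U' g xor_) h) (BoolP.xor-identityʳ (δ U' g)))
    reduce-f : ∀ U' → δ (reduce U') f ≡ false
    reduce-f U' with δ U' f in eq
    ... | false = eq
    ... | true  = trans (δ-⊻ U' U f) (cong₂ _xor_ eq Uf)
    own' : ∀ {qs} → All (λ (U' , e') → δ U' e' ≡ true) qs → All (Private (U , e)) qs →
      All (λ (U' , e') → δ U' e' ≡ true) (map reduceₚ qs)
    own' [] [] = []
    own' {(U' , e') ∷ _} (o ∷ os) ((p , _) ∷ qs) = trans (reduce-off U' e' p) o ∷ own' os qs
    privs' : ∀ {qs} → AllPairs Private qs → All (Private (U , e)) qs → AllPairs Private (map reduceₚ qs)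
    privs' [] [] = []
    privs' {(U' , e') ∷ _} (r ∷ rs) ((p , _) ∷ qs) = row r qs ∷ privs' rs qs
      where
      row : ∀ {qs} → All (Private (U' , e')) qs → All (Private (U , e)) qs → All (Private (reduce U' , e')) (map reduceₚ qs)
      row [] [] = []
      row {(U″ , e″) ∷ _} ((a , b) ∷ as) ((a' , _) ∷ bs) =
        (trans (reduce-off U' e″ a') a , trans (reduce-off U″ e' p) b) ∷ row as bs
    reduced-covers : ∀ g → coveredBy reduced g ≡ true → δ U g ∨ coveredBy ps g ≡ true
    reduced-covers g h with δ U g in eq
    ... | true  = refl
    ... | false with any-elim reduced h
    ... | _ , q∈ , δq with ∈P.∈-map⁻ reduceₚ q∈
    ... | (U' , e') , p∈ , refl = any-intro p∈ (trans (sym (reduce-off U' g eq)) δq)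
    pointwise : ∀ g → [ g ==ᵉ f ] + [ H g ] * [ coveredBy reduced g ] ≤ [ H g ] * [ coveredBy ((U , e) ∷ ps) g ]
    pointwise g = split-indicator (g ==ᵉ f) (H g) (coveredBy reduced g) (coveredBy ((U , e) ∷ ps) g) at-f (reduced-covers g)
      where
      at-f : (g ==ᵉ f) ≡ true → H g ≡ true × coveredBy ((U , e) ∷ ps) g ≡ true × coveredBy reduced g ≡ false
      at-f h with ==ᵉ⇒≡ g f h
      ... | refl = Hf , ∨-introˡ Uf , f-uncovered
        where
        f-uncovered : coveredBy reduced f ≡ false
        f-uncovered = BoolP.¬-not λ h' → case any-elim reduced h' of λ where
          (_ , q∈ , δq) → case ∈P.∈-map⁻ reduceₚ q∈ of λ where
            ((U' , e') , _ , refl) → true≢false δq (reduce-f U')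

-- A small connecting set of lonely edges

module Lonely {n : ℕ} (S L : ESet n) (S-conn : Connected S) (W : Edge n → VSet n)
  (fund : ∀ e → L e ≡ true → IsFundamental S (W e) e) where

  covered : List (Edge n) → ESet n
  covered ps f = any (λ p → δ (W p) f) ps

  -- Here and below ps are the lonely edges already scanned, the most recent one first.
  repeated : List (Edge n) → Edge n → ESet n
  repeated ps e f = δ (W e) f ∧ covered ps f

  paid : ESet n → List (Edge n) → Edge n → Bool
  paid J ps e = any (λ f → J f ∧ repeated ps e f) (edges n)

  connector : ESet n → List (Edge n) → List (Edge n) → ESet n
  connector J ps []       g = false
  connector J ps (e ∷ es) g = (paid J ps e ∧ (g ==ᵉ e)) ∨ connector J (e ∷ ps) es g

  SupportedOn : VSet n → List (Edge n) → Set
  SupportedOn U ps = ∀ g → S g ≡ true → δ U g ≡ true → g ∈ ps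

  ⊻-off : (U : VSet n) (p f : Edge n) → δ (W p) f ≡ false → δ (U ⊻ W p) f ≡ δ U f
  ⊻-off U p f h = trans (δ-⊻ U (W p) f) (trans (cong (δ U f xor_) h) (BoolP.xor-identityʳ (δ U f)))

  drop-support : (U : VSet n) (p : Edge n) (ps : List (Edge n)) → δ U p ≡ false →
    SupportedOn U (p ∷ ps) → SupportedOn U ps
  drop-support U p ps δp supp g Sg δg = case supp g Sg δg of λ where
    (here refl) → ⊥-elim (true≢false δg δp)
    (there g∈)  → g∈

  -- The cut of `W p` meets `S` only in `p`, so adding it to the cut of `U` removes `p` and changes
  -- no other tree edge.
  ⊻-support : (U : VSet n) (p : Edge n) (ps : List (Edge n)) → L p ≡ true → δ U p ≡ true →
    SupportedOn U (p ∷ ps) → SupportedOn (U ⊻ W p) ps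
  ⊻-support U p ps Lp δp supp = drop-support (U ⊻ W p) p ps
    (trans (δ-⊻ U (W p) p) (cong₂ _xor_ δp (proj₁ (proj₂ (fund p Lp)))))
    λ g Sg δg → case true-or-false (δ (W p) g) of λ where
      (inj₁ t) → here (proj₂ (proj₂ (fund p Lp)) g Sg t)
      (inj₂ f) → supp g Sg (trans (sym (⊻-off U p g f)) δg)

  -- Tree edges of the cut are cancelled one at a time by adding their cuts `W p`, none of which
  -- contains `f`. When no tree edge is left, connectivity of `S` makes the vertex set constant.
  -- This is the form in which a cut is the symmetric difference of the fundamental cuts of its tree
  -- edges.
  uncovered⇒uncut : (ps : List (Edge n)) → All (λ p → L p ≡ true) ps → (U : VSet n) → SupportedOn U ps →
    (f : Edge n) → covered ps f ≡ false → δ U f ≡ false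
  uncovered⇒uncut [] [] U supp f h =
    connected-constant S-conn U (λ g Sg → BoolP.¬-not λ δg → case supp g Sg δg of λ ()) (lo f) (hi f)
  uncovered⇒uncut (p ∷ ps) (Lp ∷ Lps) U supp f h = case true-or-false (δ U p) of λ where
    (inj₂ δp) → uncovered⇒uncut ps Lps U (drop-support U p ps δp supp) f (∨-falseʳ (δ (W p) f) h)
    (inj₁ δp) → trans (sym (⊻-off U p f (∨-falseˡ (δ (W p) f) h)))
      (uncovered⇒uncut ps Lps (U ⊻ W p) (⊻-support U p ps Lp δp supp) f (∨-falseʳ (δ (W p) f) h))

  module _ (J : ESet n) (J-crosses : ∀ e → L e ≡ true → ∃[ f ] (J f ≡ true × δ (W e) f ≡ true))
    (U : VSet n) (J-closed : ∀ f → J f ≡ true → δ U f ≡ false) where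

    -- If e is not paid for, some f ∈ J crosses its cut but no cut scanned before.
    -- The edges scanned later being uncut by U, f would be cut by U if e were.
    unpaid⇒uncut : (ps : List (Edge n)) (e : Edge n) → All (λ p → L p ≡ true) ps → L e ≡ true →
      paid J ps e ≡ false → SupportedOn U (e ∷ ps) → δ U e ≡ false
    unpaid⇒uncut ps e Lps Le unpaid supp = BoolP.¬-not λ δe → case J-crosses e Le of λ where
      (f , Jf , δf) →
        let f-fresh : covered ps f ≡ false
            f-fresh = BoolP.¬-not λ h → true≢false
              (any-intro {p = λ f → J f ∧ repeated ps e f} (∈-edges f) (∧-intro Jf (∧-intro δf h))) unpaid
        in true≢false (trans (δ-⊻ U (W e) f) (cong₂ _xor_ (J-closed f Jf) δf))
             (uncovered⇒uncut ps Lps (U ⊻ W e) (⊻-support U e ps Le δe supp) f f-fresh)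

    -- The edges scanned last are excluded from the cut first. The recursive call leaves `e` as the
    -- latest candidate; then `e` is uncut because it was bought and `U` is closed under bought
    -- edges, or by `unpaid⇒uncut`.
    closed⇒supported : (ps es : List (Edge n)) → All (λ p → L p ≡ true) ps → All (λ p → L p ≡ true) es →
      (∀ g → connector J ps es g ≡ true → δ U g ≡ false) →
      (∀ g → S g ≡ true → δ U g ≡ true → g ∈ ps ⊎ g ∈ es) → SupportedOn U ps
    closed⇒supported ps [] Lps Les conn supp g Sg δg = case supp g Sg δg of λ where
      (inj₁ g∈) → g∈
    closed⇒supported ps (e ∷ es) Lps (Le ∷ Les) conn supp = drop-support U e ps e-uncut later
      where
      later : SupportedOn U (e ∷ ps)
      later = closed⇒supported (e ∷ ps) es (Le ∷ Lps) Les
        (λ g h → conn g (∨-introʳ (paid J ps e ∧ (g ==ᵉ e)) h))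
        (λ g Sg δg → case supp g Sg δg of λ where
          (inj₁ g∈)         → inj₁ (there g∈)
          (inj₂ (here g≡))  → inj₁ (here g≡)
          (inj₂ (there g∈)) → inj₂ g∈)
      e-uncut : δ U e ≡ false
      e-uncut = case true-or-false (paid J ps e) of λ where
        (inj₁ eq) → conn e (∨-introˡ (∧-intro eq (==ᵉ-refl e)))
        (inj₂ eq) → unpaid⇒uncut ps e Lps Le eq later

  -- Different lonely edges are private to their cuts, because each `W p` crosses `S` only in `p`.
  -- Hence `rank` applies to any connected `H`, in particular to the other trees of the combination.
  connected-rank : {H : ESet n} → Connected H → (ps : List (Edge n)) → Unique ps → All (λ p → L p ≡ true) ps →
    # ps ≤ Σₑ (λ f → [ H f ] * [ covered ps f ])
  connected-rank {H} H-conn ps u Lps = subst₂ _≤_ (cong sumℚ (sym (ListP.map-∘ ps)))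
    (Σ-cong (edges n) (λ f → cong (λ bs → [ H f ] * [ foldr _∨_ false bs ]) (sym (ListP.map-∘ ps))))
    (rank H-conn (map (λ p → W p , p) ps) (AllP.map⁺ (All.map (λ {p} Lp → proj₁ (proj₂ (fund p Lp))) Lps))
      (AllPairsP.map⁺ (privates u Lps)))
    where
    avoid : ∀ {p q} → L p ≡ true → L q ≡ true → p ≢ q → δ (W p) q ≡ false
    avoid {p} {q} Lp Lq p≢q = BoolP.¬-not λ h → p≢q (sym (proj₂ (proj₂ (fund p Lp)) q (proj₁ (fund q Lq)) h))
    privates : ∀ {ps} → Unique ps → All (λ p → L p ≡ true) ps → AllPairs (λ p q → Private (W p , p) (W q , q)) ps
    privates [] [] = []
    privates (p∉ ∷ u) (Lp ∷ Lps) =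
      All.zipWith (λ (p≢q , Lq) → avoid Lp Lq p≢q , avoid Lq Lp (p≢q ∘ sym)) (p∉ , Lps) ∷ privates u Lps

-- Cost of the bought edges

module LonelyCost {n : ℕ} (S L : ESet n) (S-conn : Connected S) (W : Edge n → VSet n)
  (fund : ∀ e → L e ≡ true → IsFundamental S (W e) e)
  (c : Edge n → ℚ) (0≤c : ∀ e → 0ℚ ≤ c e) where

  open Lonely S L S-conn W fund

  -- The charge of an edge `f` of the join: the total cost of the edges in `es` whose purchase `f`
  -- alone would trigger.
  weight : List (Edge n) → List (Edge n) → Edge n → ℚ
  weight ps []       f = 0ℚ
  weight ps (e ∷ es) f = c e * [ repeated ps e f ] + weight (e ∷ ps) es f

  -- A union bound: if `e` is bought, a single witness `f` in `J` already contributes the whole of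
  -- `c e` on the right.
  paid-cost : (J : ESet n) (ps : List (Edge n)) (e : Edge n) →
    Σₑ (λ g → [ paid J ps e ∧ (g ==ᵉ e) ] * c g) ≤ Σₑ (λ f → [ J f ] * (c e * [ repeated ps e f ]))
  paid-cost J ps e = go (paid J ps e) refl
    where
    0≤term : ∀ {f} → f ∈ edges n → 0ℚ ≤ [ J f ] * (c e * [ repeated ps e f ])
    0≤term {f} _ = 0≤* 0≤[ J f ] (0≤* (0≤c e) 0≤[ repeated ps e f ])
    go : ∀ b → paid J ps e ≡ b →
      Σₑ (λ g → [ b ∧ (g ==ᵉ e) ] * c g) ≤ Σₑ (λ f → [ J f ] * (c e * [ repeated ps e f ]))
    go false _ = subst (_≤ Σₑ (λ f → [ J f ] * (c e * [ repeated ps e f ])))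
      (sym (Σ-zero (edges n) (λ {g} _ → ℚP.*-zeroˡ (c g)))) (Σ-nonNeg (edges n) 0≤term)
    go true h with any-elim {p = λ f → J f ∧ repeated ps e f} (edges n) h
    ... | f , f∈ , hf with ∧-elim {J f} hf
    ... | Jf , rf = begin
      Σₑ (λ g → [ g ==ᵉ e ] * c g) ≤⟨ Σ-indicator≤ c 0≤c e ⟩
      c e ≡⟨ sym (trans (ℚP.*-identityˡ _) (ℚP.*-identityʳ (c e))) ⟩
      1ℚ * (c e * 1ℚ) ≡⟨ sym (cong₂ (λ a b → [ a ] * (c e * [ b ])) Jf rf) ⟩
      [ J f ] * (c e * [ repeated ps e f ]) ≤⟨ term≤Σ 0≤term f∈ ⟩
      Σₑ (λ f → [ J f ] * (c e * [ repeated ps e f ])) ∎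
      where open ℚP.≤-Reasoning

  [∨]≤ : ∀ a b {q} → 0ℚ ≤ q → [ a ∨ b ] * q ≤ [ a ] * q + [ b ] * q
  [∨]≤ false b {q} 0≤q = ℚP.≤-reflexive (sym (trans (cong (_+ [ b ] * q) (ℚP.*-zeroˡ q)) (ℚP.+-identityˡ _)))
  [∨]≤ true  b {q} 0≤q = subst (_≤ 1ℚ * q + [ b ] * q) (ℚP.+-identityʳ (1ℚ * q)) (ℚP.+-monoʳ-≤ (1ℚ * q) (0≤* 0≤[ b ] 0≤q))

  -- The bound is linear in the incidence vector of `J`, so its expectation depends only on the
  -- expected join.
  connector-cost : (J : ESet n) (ps es : List (Edge n)) →
    c ⟨ connector J ps es ⟩ ≤ Σₑ (λ f → [ J f ] * weight ps es f)
  connector-cost J ps [] = ℚP.≤-reflexive (trans (Σ-zero (edges n) (λ {g} _ → ℚP.*-zeroˡ (c g)))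
    (sym (Σ-zero (edges n) (λ {f} _ → ℚP.*-zeroʳ [ J f ]))))
  connector-cost J ps (e ∷ es) = begin
    Σₑ (λ g → [ (paid J ps e ∧ (g ==ᵉ e)) ∨ connector J (e ∷ ps) es g ] * c g)
      ≤⟨ Σ-mono (edges n) (λ g → [∨]≤ (paid J ps e ∧ (g ==ᵉ e)) (connector J (e ∷ ps) es g) (0≤c g)) ⟩
    Σₑ (λ g → [ paid J ps e ∧ (g ==ᵉ e) ] * c g + [ connector J (e ∷ ps) es g ] * c g)
      ≡⟨ Σ-+ (edges n) _ _ ⟩
    Σₑ (λ g → [ paid J ps e ∧ (g ==ᵉ e) ] * c g) + c ⟨ connector J (e ∷ ps) es ⟩
      ≤⟨ ℚP.+-mono-≤ (paid-cost J ps e) (connector-cost J (e ∷ ps) es) ⟩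
    Σₑ (λ f → [ J f ] * (c e * [ repeated ps e f ])) + Σₑ (λ f → [ J f ] * weight (e ∷ ps) es f)
      ≡⟨ sym (Σ-+ (edges n) _ _) ⟩
    Σₑ (λ f → [ J f ] * (c e * [ repeated ps e f ]) + [ J f ] * weight (e ∷ ps) es f)
      ≡⟨ Σ-cong (edges n) (λ f → sym (ℚP.*-distribˡ-+ [ J f ] _ _)) ⟩
    Σₑ (λ f → [ J f ] * weight ps (e ∷ es) f) ∎
    where open ℚP.≤-Reasoning

  -- The invariant of the scan. Its field `disjoint` ensures that an edge counted by `repeated` lies
  -- in the cuts of two different lonely edges.
  record Scan (ps es : List (Edge n)) : Set where
    field
      ps-unique : Unique ps
      es-unique : Unique es
      disjoint  : ∀ {e} → e ∈ es → e ∈ ps → ⊥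
      ps-lonely : All (λ p → L p ≡ true) ps
      es-lonely : All (λ e → L e ≡ true) es
  open Scan

  advance : ∀ {ps e es} → Scan ps (e ∷ es) → Scan (e ∷ ps) es
  advance s = record
    { ps-unique = All.tabulate (λ p∈ e≡p → disjoint s (here (sym e≡p)) p∈) ∷ ps-unique s
    ; es-unique = AllPairs.tail (es-unique s)
    ; disjoint  = λ { g∈es (here refl)  → All.lookup (AllPairs.head (es-unique s)) g∈es refl
                    ; g∈es (there g∈ps) → disjoint s (there g∈es) g∈ps }
    ; ps-lonely = All.head (es-lonely s) ∷ ps-lonely s
    ; es-lonely = All.tail (es-lonely s)
    }

  -- A nonzero weight forces `f` into the cuts of two different lonely edges, so agreement of `y`
  -- and `z` on such edges is enough.
  weight-cong : {y z : Edge n → ℚ} →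
    (∀ e e' f → L e ≡ true → L e' ≡ true → e ≢ e' → δ (W e) f ≡ true → δ (W e') f ≡ true → y f ≡ z f) →
    ∀ {ps} es → Scan ps es → ∀ f → y f * weight ps es f ≡ z f * weight ps es f
  weight-cong {y} {z} agree [] s f = trans (ℚP.*-zeroʳ (y f)) (sym (ℚP.*-zeroʳ (z f)))
  weight-cong {y} {z} agree {ps} (e ∷ es) s f = begin
    y f * (c e * [ repeated ps e f ] + weight (e ∷ ps) es f)
      ≡⟨ ℚP.*-distribˡ-+ (y f) _ _ ⟩
    y f * (c e * [ repeated ps e f ]) + y f * weight (e ∷ ps) es f
      ≡⟨ cong₂ _+_ (first (repeated ps e f) refl) (weight-cong agree es (advance s) f) ⟩
    z f * (c e * [ repeated ps e f ]) + z f * weight (e ∷ ps) es f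
      ≡⟨ sym (ℚP.*-distribˡ-+ (z f) _ _) ⟩
    z f * (c e * [ repeated ps e f ] + weight (e ∷ ps) es f) ∎
    where
    open ≡-Reasoning
    first : ∀ b → repeated ps e f ≡ b → y f * (c e * [ b ]) ≡ z f * (c e * [ b ])
    first false _ = trans (cong (y f *_) (ℚP.*-zeroʳ (c e))) (trans (ℚP.*-zeroʳ (y f))
      (sym (trans (cong (z f *_) (ℚP.*-zeroʳ (c e))) (ℚP.*-zeroʳ (z f)))))
    first true h with ∧-elim {δ (W e) f} h
    ... | δe , cov with any-elim ps cov
    ... | p , p∈ , δp = cong (_* (c e * 1ℚ)) (agree e p f (All.head (es-lonely s)) (All.lookup (ps-lonely s) p∈)
            (λ { refl → disjoint s (here refl) p∈ }) δe δp)

  module _ (x : Edge n → ℚ)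
    (x-rank : ∀ ps → Unique ps → All (λ p → L p ≡ true) ps → # ps ≤ Σₑ (λ f → x f * [ covered ps f ])) where

    -- Inclusion-exclusion for the cut of `W e` and the union of the earlier cuts: `repeated` is
    -- their intersection, and `covered (e ∷ ps)` their union.
    repeated-mass : (ps : List (Edge n)) (e : Edge n) →
      Σₑ (λ f → x f * [ repeated ps e f ])
        ≡ x ⟨ δ (W e) ⟩ + Σₑ (λ f → x f * [ covered ps f ]) - Σₑ (λ f → x f * [ covered (e ∷ ps) f ])
    repeated-mass ps e = begin
      M ≡⟨ solve 2 (λ m p → m := m :+ p :- p) refl M P' ⟩
      M + P' - P' ≡⟨ cong (_- P') (trans (sym (Σ-+ (edges n) _ _))
        (trans (Σ-cong (edges n) (λ f → modular (x f) (δ (W e) f) (covered ps f))) (Σ-+ (edges n) _ _))) ⟩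
      X + P - P' ∎
      where
      open ≡-Reasoning
      open +-*-Solver
      M P P' X : ℚ
      M  = Σₑ (λ f → x f * [ repeated ps e f ])
      P  = Σₑ (λ f → x f * [ covered ps f ])
      P' = Σₑ (λ f → x f * [ covered (e ∷ ps) f ])
      X  = x ⟨ δ (W e) ⟩
      modular : ∀ q a b → q * [ a ∧ b ] + q * [ a ∨ b ] ≡ [ a ] * q + q * [ b ]
      modular q true  true  = cong (_+ q * 1ℚ) (ℚP.*-comm q 1ℚ)
      modular q true  false = trans (ℚP.+-comm (q * 0ℚ) (q * 1ℚ)) (cong (_+ q * 0ℚ) (ℚP.*-comm q 1ℚ))
      modular q false b     = cong (_+ q * [ b ]) (ℚP.*-comm q 0ℚ)

    -- Abel summation: the excess of covered mass over # ps is nonnegative by x-rank,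
    -- and its coefficient θ bounds the remaining costs.
    weight-bound : (θ : ℚ) {ps : List (Edge n)} (es : List (Edge n)) → Scan ps es →
      All (λ e → c e ≤ θ) es → AllPairs (λ e e' → c e' ≤ c e) es → 0ℚ ≤ θ →
      Σₑ (λ f → x f * weight ps es f)
        ≤ Σ[ es ] (λ e → (x ⟨ δ (W e) ⟩ - 1ℚ) * c e) + θ * (Σₑ (λ f → x f * [ covered ps f ]) - # ps)
    weight-bound θ {ps} [] s _ _ 0≤θ = subst₂ _≤_
      (sym (Σ-zero (edges n) (λ {f} _ → ℚP.*-zeroʳ (x f)))) (sym (ℚP.+-identityˡ _))
      (0≤* 0≤θ (p≤q⇒0≤q-p (x-rank ps (ps-unique s) (ps-lonely s))))
    weight-bound θ {ps} (e ∷ es) s (e≤θ ∷ _) (e≥ ∷ desc) 0≤θ = begin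
      Σₑ (λ f → x f * (c e * [ repeated ps e f ] + weight (e ∷ ps) es f))
        ≡⟨ Σ-cong (edges n) (λ f → expand (x f) (c e) [ repeated ps e f ] (weight (e ∷ ps) es f)) ⟩
      Σₑ (λ f → c e * (x f * [ repeated ps e f ]) + x f * weight (e ∷ ps) es f)
        ≡⟨ trans (Σ-+ (edges n) _ _) (cong (_+ Σₑ (λ f → x f * weight (e ∷ ps) es f))
             (trans (Σ-*ˡ (edges n) (c e) _) (cong (c e *_) (repeated-mass ps e)))) ⟩
      c e * (X + P - P') + Σₑ (λ f → x f * weight (e ∷ ps) es f)
        -- The recursion takes `c e` as its new `θ`: costs descend, so `c e` bounds all later ones.
        ≤⟨ ℚP.+-monoʳ-≤ (c e * (X + P - P')) (weight-bound (c e) es (advance s) e≥ desc (0≤c e)) ⟩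
      c e * (X + P - P') + (R + c e * (P' - (1ℚ + # ps)))
        -- The mass `P'` cancels between the repeated mass and the recursive excess. Only the excess
        -- before `e` survives, with coefficient `c e`.
        ≡⟨ regroup (c e) X P P' R (# ps) ⟩
      ((X - 1ℚ) * c e + R) + c e * (P - # ps)
        ≤⟨ ℚP.+-monoʳ-≤ ((X - 1ℚ) * c e + R)
             (*-monoʳ-≤ (p≤q⇒0≤q-p (x-rank ps (ps-unique s) (ps-lonely s))) e≤θ) ⟩
      ((X - 1ℚ) * c e + R) + θ * (P - # ps) ∎
      where
      open ℚP.≤-Reasoning
      P P' X R : ℚ
      P  = Σₑ (λ f → x f * [ covered ps f ])
      P' = Σₑ (λ f → x f * [ covered (e ∷ ps) f ])
      X  = x ⟨ δ (W e) ⟩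
      R  = Σ[ es ] (λ e → (x ⟨ δ (W e) ⟩ - 1ℚ) * c e)
      open +-*-Solver
      expand : ∀ a b d w → a * (b * d + w) ≡ b * (a * d) + a * w
      expand = solve 4 (λ a b d w → a :* (b :* d :+ w) := b :* (a :* d) :+ a :* w) refl
      regroup : ∀ a X P P' R k →
        a * (X + P - P') + (R + a * (P' - (1ℚ + k))) ≡ ((X - 1ℚ) * a + R) + a * (P - k)
      regroup = solve 6 (λ a X P P' R k →
        a :* (X :+ P :- P') :+ (R :+ a :* (P' :- (con 1ℚ :+ k))) := ((X :- con 1ℚ) :* a :+ R) :+ a :* (P :- k)) refl

    -- At the start nothing is covered and nothing scanned, so the excess is zero and the choice of
    -- `θ` as the largest cost contributes nothing.
    total-weight-bound : (es : List (Edge n)) → Unique es → All (λ e → L e ≡ true) es →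
      AllPairs (λ e e' → c e' ≤ c e) es →
      Σₑ (λ f → x f * weight [] es f) ≤ Σ[ es ] (λ e → (x ⟨ δ (W e) ⟩ - 1ℚ) * c e)
    total-weight-bound [] _ _ _ = ℚP.≤-reflexive (Σ-zero (edges n) (λ {f} _ → ℚP.*-zeroʳ (x f)))
    total-weight-bound (e ∷ es) u Les desc = subst (Σₑ (λ f → x f * weight [] (e ∷ es) f) ≤_) no-excess
      (weight-bound (c e) (e ∷ es) start (ℚP.≤-refl ∷ AllPairs.head desc) desc (0≤c e))
      where
      start : Scan [] (e ∷ es)
      start = record { ps-unique = [] ; es-unique = u ; disjoint = λ _ () ; ps-lonely = [] ; es-lonely = Les }
      no-excess : Σ[ e ∷ es ] (λ e → (x ⟨ δ (W e) ⟩ - 1ℚ) * c e) + c e * (Σₑ (λ f → x f * 0ℚ) - 0ℚ)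
        ≡ Σ[ e ∷ es ] (λ e → (x ⟨ δ (W e) ⟩ - 1ℚ) * c e)
      no-excess = trans (cong (λ q → R + c e * (q - 0ℚ)) (Σ-zero (edges n) (λ {f} _ → ℚP.*-zeroʳ (x f))))
        (trans (cong (R +_) (ℚP.*-zeroʳ (c e))) (ℚP.+-identityʳ R))
        where
        R : ℚ
        R = Σ[ e ∷ es ] (λ e → (x ⟨ δ (W e) ⟩ - 1ℚ) * c e)

-- Minimal connecting sets

-- Greedy deletion: each edge is discarded if connectivity survives without it. An edge once found
-- indispensable stays so after further deletions, by monotonicity of reachability. The connectivity
-- tests use excluded middle, hence the double negation.
minimal-connector : {G D : ESet n} → Connected (G ∪ᵉ D) →
  ¬ ¬ (∃[ D' ] (IsContractedST G D' × (∀ e → D' e ≡ true → D e ≡ true)))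
minimal-connector {n} {G} {D} GD-conn = ¬¬-map
  (λ (D' , conn , minimal , D'⊆D) → D' , (conn , λ e → minimal (∈-edges e)) , D'⊆D) (thin (edges n))
  where
  Thinned : List (Edge n) → ESet n → Set
  Thinned es D' = Connected (G ∪ᵉ D') × (∀ {e} → e ∈ es → D' e ≡ true → ¬ Connected (G ∪ᵉ remove D' e))
                  × (∀ e → D' e ≡ true → D e ≡ true)

  discard : ∀ {e es D'} → Thinned es D' → Dec (Connected (G ∪ᵉ remove D' e)) → ∃ (Thinned (e ∷ es))
  discard {e} {es} {D'} (conn , minimal , D'⊆D) (no ¬conn) =
    D' , conn , (λ { (here refl) _ → ¬conn ; (there e∈) → minimal e∈ }) , D'⊆D
  discard {e} {es} {D'} (conn , minimal , D'⊆D) (yes conn') = remove D' e , conn' , minimal' , λ g → D'⊆D g ∘ kept g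
    where
    kept : ∀ g → remove D' e g ≡ true → D' g ≡ true
    kept g = proj₁ ∘ ∧-elim {D' g}
    minimal' : ∀ {g} → g ∈ e ∷ es → remove D' e g ≡ true → ¬ Connected (G ∪ᵉ remove (remove D' e) g)
    minimal' (here refl) h _ =
      true≢false (==ᵉ-refl e) (trans (sym (BoolP.not-involutive (e ==ᵉ e))) (cong not (proj₂ (∧-elim {D' e} h))))
    minimal' {g} (there g∈) h conn″ = minimal g∈ (kept g h) λ u v → reach-mono larger (conn″ u v)
      where
      larger : ∀ f → (G ∪ᵉ remove (remove D' e) g) f ≡ true → (G ∪ᵉ remove D' g) f ≡ true
      larger f r = case ∨-elim {G f} r of λ where
        (inj₁ Gf) → ∨-introˡ Gf
        (inj₂ q)  → case ∧-elim {remove D' e f} q of λ where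
          (a , b) → ∨-introʳ (G f) (∧-intro (kept f a) b)

  thin : ∀ es → ¬ ¬ ∃ (Thinned es)
  thin []       k = k (D , GD-conn , (λ ()) , λ _ h → h)
  thin (e ∷ es) k = thin es λ (D' , th) → ¬¬-excluded-middle λ d → k (discard th d)

mass-mono : {c : Edge n → ℚ} → (∀ e → 0ℚ ≤ c e) → {H H' : ESet n} → (∀ e → H e ≡ true → H' e ≡ true) →
  c ⟨ H ⟩ ≤ c ⟨ H' ⟩
mass-mono {n} {c} 0≤c {H} {H'} H⊆H' = Σ-mono (edges n) λ e → *-monoʳ-≤ (0≤c e) (indicator (H e) (H' e) (H⊆H' e))
  where
  indicator : ∀ a b → (a ≡ true → b ≡ true) → [ a ] ≤ [ b ]
  indicator false b _ = 0≤[ b ]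
  indicator true  b h rewrite h refl = ℚP.≤-refl

mass-cong : (z : Edge n → ℚ) {H H' : ESet n} → (∀ e → H e ≡ H' e) → z ⟨ H ⟩ ≡ z ⟨ H' ⟩
mass-cong {n} z h = Σ-cong (edges n) λ e → cong (λ b → [ b ] * z e) (h e)

-- Narrow cuts

-- As for `edges`; the two fields are the local function applied to false and to true.
record SubsetsForm (n : ℕ) : Set where
  field
    without with₀ : VSet n → VSet (suc n)
    subsets≡ : subsets (suc n) ≡ concatMap (λ U → without U ∷ with₀ U ∷ []) (subsets n)

subsetsForm : ∀ n → SubsetsForm n
subsetsForm n = record { without = _ ; with₀ = _ ; subsets≡ = refl }

-- Vertex sets are functions, so the listed copy of `U` is only required to agree with it pointwise.
subsets-complete : (U : VSet n) → ∃[ U' ] (U' ∈ subsets n × (∀ v → U' v ≡ U v))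
subsets-complete {zero}  U = _ , here refl , λ ()
subsets-complete {suc n} U with subsets-complete (U ∘ Fin.suc) | true-or-false (U Fin.zero)
... | U' , U'∈ , eq | inj₂ u₀ =
  without U' , ∈P.∈-concatMap⁺ (λ U → without U ∷ with₀ U ∷ []) (lose U'∈ (here refl)) ,
  λ { Fin.zero → sym u₀ ; (Fin.suc i) → eq i }
  where open SubsetsForm (subsetsForm n)
... | U' , U'∈ , eq | inj₁ u₀ =
  with₀ U' , ∈P.∈-concatMap⁺ (λ U → without U ∷ with₀ U ∷ []) (lose U'∈ (there (here refl))) ,
  λ { Fin.zero → sym u₀ ; (Fin.suc i) → eq i }
  where open SubsetsForm (subsetsForm n)

sameESet-sound : (H H' : ESet n) → sameESet H H' ≡ true → ∀ e → H e ≡ H' e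
sameESet-sound {n} H H' h e = does-true (H e Bool.≟ H' e)
  (T⇒≡ (All.lookup (AllP.all⁺ (λ e → ⌊ H e Bool.≟ H' e ⌋) (edges n) (≡⇒T h)) (∈-edges e)))

-- A representative of `H` found in the tail either survives the filter for the head `G`, or was
-- removed because it agrees with `G`, which then represents `H`.
∈-deduplicate-sameESet : (Hs : List (ESet n)) {H : ESet n} → H ∈ Hs →
  ∃[ H' ] (H' ∈ deduplicateᵇ sameESet Hs × (∀ e → H' e ≡ H e))
∈-deduplicate-sameESet (H ∷ Hs) (here refl) = H , here refl , λ _ → refl
∈-deduplicate-sameESet (G ∷ Hs) (there H∈) with ∈-deduplicate-sameESet Hs H∈
... | H' , H'∈ , eq with true-or-false (sameESet G H')
... | inj₁ same = G , here refl , λ e → trans (sameESet-sound G H' same e) (eq e)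
... | inj₂ diff = H' , there (∈P.∈-filter⁺ _ H'∈ λ same → true≢false (T⇒≡ same) diff) , eq

module _ (x : Edge n → ℚ) where

  cutE-cong : {U U' : VSet n} → (∀ v → U v ≡ U' v) → ∀ e → cutE x U e ≡ cutE x U' e
  cutE-cong h e = cong (_∧ supp x e) (cong₂ _xor_ (h (lo e)) (h (hi e)))

  narrowᵇ-cong : {U U' : VSet n} → (∀ v → U v ≡ U' v) → narrowᵇ x U ≡ narrowᵇ x U'
  narrowᵇ-cong h = cong₂ _∧_ (any-cong (allFin n) h) (cong₂ _∧_ (any-cong (allFin n) (cong not ∘ h))
    (cong (_<ᵇ 2ℚ) (mass-cong x (cutE-cong h))))

  ∈-narrowCuts⁺ : (U : VSet n) → narrowᵇ x U ≡ true → ∃[ Q ] (Q ∈ narrowCuts x × (∀ e → Q e ≡ cutE x U e))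
  ∈-narrowCuts⁺ U narrow =
    let (U' , U'∈ , eq) = subsets-complete U
        (Q , Q∈ , eq')  = ∈-deduplicate-sameESet (map (cutE x) (filterᵇ (narrowᵇ x) (subsets n)))
          (∈P.∈-map⁺ (cutE x) (∈-filterᵇ⁺ (narrowᵇ x) U'∈ (trans (narrowᵇ-cong eq) narrow)))
    in Q , Q∈ , λ e → trans (eq' e) (cutE-cong eq e)

  ∈-narrowCuts⁻ : ∀ {Q} → Q ∈ narrowCuts x → ∃[ U ] (narrowᵇ x U ≡ true × Q ≡ cutE x U)
  ∈-narrowCuts⁻ Q∈ =
    let (U , U∈ , eq) = ∈P.∈-map⁻ (cutE x) (∈P.∈-deduplicate⁻ (λ H H' → BoolP.T? (sameESet H H'))
          (map (cutE x) (filterᵇ (narrowᵇ x) (subsets n))) Q∈)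
    in U , proj₂ (∈-filterᵇ⁻ (narrowᵇ x) {subsets n} U∈) , eq

lonelyAt-cong : (S L : ESet n) {Q Q' : ESet n} → (∀ e → Q e ≡ Q' e) → ∀ e → lonelyAt S L Q e ≡ lonelyAt S L Q' e
lonelyAt-cong S L {Q} {Q'} h e = cong₂ (λ q k → L e ∧ S e ∧ q ∧ (k ℕ.≡ᵇ 1)) (h e)
  (card-cong {H = Q ∩ᵉ S} {Q' ∩ᵉ S} (λ g → cong (_∧ S g) (h g)))

lonelyAt-intro : (S L Q : ESet n) {e : Edge n} → L e ≡ true → S e ≡ true → Q e ≡ true → card (Q ∩ᵉ S) ≡ 1 →
  lonelyAt S L Q e ≡ true
lonelyAt-intro S L Q Le Se Qe one = ∧-intro Le (∧-intro Se (∧-intro Qe (cong (ℕ._≡ᵇ 1) one)))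

lonelyAt-elim : (S L Q : ESet n) {e : Edge n} → lonelyAt S L Q e ≡ true →
  L e ≡ true × S e ≡ true × Q e ≡ true × card (Q ∩ᵉ S) ≡ 1
lonelyAt-elim S L Q {e} h with ∧-elim {L e} h
... | Le , h₁ with ∧-elim {S e} h₁
... | Se , h₂ with ∧-elim {Q e} h₂
... | Qe , h₃ = Le , Se , Qe , ℕP.≡ᵇ⇒≡ (card (Q ∩ᵉ S)) 1 (≡⇒T h₃)

-- Narrow cuts of a feasible LP solution

module FeasibleCuts {n : ℕ} (s t : Fin n) (x : Edge n → ℚ) (feas : Feasible s t x) where

  -- Outside the support `x` is zero, being nonnegative but not positive.
  mass-cutE : (U : VSet n) → x ⟨ cutE x U ⟩ ≡ x ⟨ δ U ⟩
  mass-cutE U = Σ-cong (edges n) λ e → outside (δ U e) e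
    where
    outside : ∀ b e → [ b ∧ supp x e ] * x e ≡ [ b ] * x e
    outside false e = refl
    outside true  e with 0ℚ ℚP.<? x e
    ... | yes _   = refl
    ... | no 0≮xe = trans (ℚP.*-zeroˡ (x e)) (trans (ℚP.≤-antisym (proj₁ feas e) (ℚP.≮⇒≥ 0≮xe)) (sym (ℚP.*-identityˡ (x e))))

  narrow-elim : (U : VSet n) → narrowᵇ x U ≡ true → fval s t U ≤ x ⟨ cutE x U ⟩ × x ⟨ cutE x U ⟩ < 2ℚ
  narrow-elim U h with ∧-elim {nonemptyᵇ U} h
  ... | ne , h' with ∧-elim {properᵇ U} h'
  ... | pr , lt = subst (fval s t U ≤_) (sym (mass-cutE U)) (proj₂ (proj₂ feas) U ne pr) ,
                  does-true (x ⟨ cutE x U ⟩ ℚP.<? 2ℚ) lt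

  -- Otherwise the LP constraint would force mass at least 2 on a cut of mass below 2.
  narrow⇒separates : (U : VSet n) → narrowᵇ x U ≡ true → U s xor U t ≡ true
  narrow⇒separates U h = by-cases (U s xor U t) refl
    where
    by-cases : ∀ b → U s xor U t ≡ b → b ≡ true
    by-cases true  _  = refl
    by-cases false eq = ⊥-elim (ℚP.<-irrefl refl (ℚP.≤-<-trans
      (subst (λ b → (if b then 1ℚ else 2ℚ) ≤ x ⟨ cutE x U ⟩) eq (proj₁ (narrow-elim U h)))
      (proj₂ (narrow-elim U h))))

  narrow⇒1≤ : (U : VSet n) → narrowᵇ x U ≡ true → 1ℚ ≤ x ⟨ cutE x U ⟩
  narrow⇒1≤ U h = subst (λ b → (if b then 1ℚ else 2ℚ) ≤ x ⟨ cutE x U ⟩) (narrow⇒separates U h) (proj₁ (narrow-elim U h))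

  -- For each lonely `e` the chosen cut `W e` supplies one term of the right-hand side. An edge may
  -- be lonely in further cuts, but their terms are nonnegative because narrow cuts have mass at
  -- least 1.
  rhsBound-≥ : {c : Edge n → ℚ} → (∀ e → 0ℚ ≤ c e) → (S L : ESet n) (W : Edge n → VSet n) →
    (∀ e → L e ≡ true → narrowᵇ x (W e) ≡ true × lonelyAt S L (cutE x (W e)) e ≡ true) →
    Σₑ (λ e → [ L e ] * ((x ⟨ δ (W e) ⟩ - 1ℚ) * c e)) ≤ rhsBound x c S L
  rhsBound-≥ {c} 0≤c S L W lonely-cut =
    subst (Σₑ (λ e → [ L e ] * ((x ⟨ δ (W e) ⟩ - 1ℚ) * c e)) ≤_)
      (sym (Σ-swap (narrowCuts x) (edges n) term)) (Σ-mono (edges n) λ e → bound e (L e) refl)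
    where
    term : ESet n → Edge n → ℚ
    term Q e = [ lonelyAt S L Q e ] * ((x ⟨ Q ⟩ - 1ℚ) * c e)
    0≤term : ∀ e {Q} → Q ∈ narrowCuts x → 0ℚ ≤ term Q e
    0≤term e {Q} Q∈ = 0≤* 0≤[ lonelyAt S L Q e ] (0≤* (p≤q⇒0≤q-p (1≤mass (∈-narrowCuts⁻ x Q∈))) (0≤c e))
      where
      1≤mass : ∃[ U ] (narrowᵇ x U ≡ true × Q ≡ cutE x U) → 1ℚ ≤ x ⟨ Q ⟩
      1≤mass (U , narrow , eq) = subst (λ Q → 1ℚ ≤ x ⟨ Q ⟩) (sym eq) (narrow⇒1≤ U narrow)
    bound : ∀ e b → L e ≡ b → [ b ] * ((x ⟨ δ (W e) ⟩ - 1ℚ) * c e) ≤ Σ[ narrowCuts x ] (λ Q → term Q e)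
    bound e false _ = subst (_≤ Σ[ narrowCuts x ] (λ Q → term Q e)) (sym (ℚP.*-zeroˡ ((x ⟨ δ (W e) ⟩ - 1ℚ) * c e)))
      (Σ-nonNeg (narrowCuts x) (0≤term e))
    bound e true Le = attained (∈-narrowCuts⁺ x (W e) (proj₁ (lonely-cut e Le)))
      where
      attained : ∃[ Q ] (Q ∈ narrowCuts x × (∀ g → Q g ≡ cutE x (W e) g)) →
        [ true ] * ((x ⟨ δ (W e) ⟩ - 1ℚ) * c e) ≤ Σ[ narrowCuts x ] (λ Q → term Q e)
      attained (Q , Q∈ , eq) =
        subst (_≤ Σ[ narrowCuts x ] (λ Q → term Q e)) term≡ (term≤Σ {f = λ Q → term Q e} (0≤term e) Q∈)
        where
        term≡ : term Q e ≡ [ true ] * ((x ⟨ δ (W e) ⟩ - 1ℚ) * c e)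
        term≡ = cong₂ (λ b q → [ b ] * ((q - 1ℚ) * c e)) (trans (lonelyAt-cong S L eq e) (proj₂ (lonely-cut e Le)))
          (trans (mass-cong x eq) (mass-cutE (W e)))

-- Layered combinations

module LayeredTree {n : ℕ} (s t : Fin n) (x : Edge n → ℚ) (feas : Feasible s t x)
  {m : ℕ} (C : TreeComb n m) (layered : IsLayered x C) (k : Fin m) where

  open FeasibleCuts s t x feas

  S L F : ESet n
  S = tree C k
  L = lonely C k
  F = S ∖ᵉ L

  0<coef : ∀ j → 0ℚ < coef C j
  0<coef = proj₁ (proj₁ layered)

  Σcoef≡1 : Σ[ allFin m ] (coef C) ≡ 1ℚ
  Σcoef≡1 = proj₁ (proj₂ (proj₁ layered))

  tree-connected : ∀ j → Connected (tree C j)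
  tree-connected j = proj₁ (proj₁ (proj₂ (proj₂ (proj₁ layered))) j)

  tree⊆supp : ∀ j e → tree C j e ≡ true → supp x e ≡ true
  tree⊆supp = proj₁ (proj₂ (proj₂ (proj₂ (proj₁ layered))))

  LonelyCut : Edge n → VSet n → Set
  LonelyCut e U = narrowᵇ x U ≡ true × cutE x U e ≡ true × card (cutE x U ∩ᵉ S) ≡ 1

  lonely⇒tree×cut : ∀ e → L e ≡ true → S e ≡ true × ∃ (LonelyCut e)
  lonely⇒tree×cut = proj₂ (proj₂ (proj₂ (proj₂ (proj₁ layered)))) k

  x-expectation : ∀ e → Σ[ allFin m ] (λ j → coef C j * [ tree C j e ]) ≡ x e
  x-expectation = proj₁ (proj₂ layered)

  tree-layered : ∀ j → IsLayeredTree x C j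
  tree-layered = proj₂ (proj₂ (proj₂ layered))

  -- A lonely cut is available only from a proof that the edge is lonely. The empty set as default
  -- makes `W` a total function.
  choose : (b : Bool) → (b ≡ true → VSet n) → VSet n
  choose true  U = U refl
  choose false U = λ _ → false

  choose-spec : {R : VSet n → Set} (b : Bool) (U : b ≡ true → VSet n) → (∀ p → R (U p)) → b ≡ true → R (choose b U)
  choose-spec true U h refl = h refl

  W : Edge n → VSet n
  W e = choose (L e) (λ Le → proj₁ (proj₂ (lonely⇒tree×cut e Le)))

  W-lonely : ∀ e → L e ≡ true → LonelyCut e (W e)
  W-lonely e = choose-spec {LonelyCut e} (L e) (λ Le → proj₁ (proj₂ (lonely⇒tree×cut e Le)))
    (λ Le → proj₂ (proj₂ (lonely⇒tree×cut e Le)))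

  -- Tree edges lie in the support, so restricting the cut to the support loses none of them.
  one-edge : ∀ j (U : VSet n) → card (cutE x U ∩ᵉ tree C j) ≡ 1 → ∀ {e g} →
    tree C j e ≡ true → δ U e ≡ true → tree C j g ≡ true → δ U g ≡ true → e ≡ g
  one-edge j U one {e} {g} Se δe Sg δg = card-1⇒≡ {H = cutE x U ∩ᵉ tree C j} one
    (∧-intro (∧-intro δe (tree⊆supp j e Se)) Se) (∧-intro (∧-intro δg (tree⊆supp j g Sg)) Sg)

  fund : ∀ e → L e ≡ true → IsFundamental S (W e) e
  fund e Le = Se , δe , λ g Sg δg → one-edge k (W e) one Sg δg Se δe
    where
    Se : S e ≡ true
    Se = proj₁ (lonely⇒tree×cut e Le)
    δe : δ (W e) e ≡ true
    δe = proj₁ (∧-elim {δ (W e) e} (proj₁ (proj₂ (W-lonely e Le))))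
    one : card (cutE x (W e) ∩ᵉ S) ≡ 1
    one = proj₂ (proj₂ (W-lonely e Le))

  lonelyAt-W : ∀ e → L e ≡ true → lonelyAt S L (cutE x (W e)) e ≡ true
  lonelyAt-W e Le = lonelyAt-intro S L (cutE x (W e)) Le (proj₁ (fund e Le))
    (proj₁ (proj₂ (W-lonely e Le))) (proj₂ (proj₂ (W-lonely e Le)))

  open Lonely S L (tree-connected k) W fund

  -- Average of `connected-rank` over all trees of the combination, whose expectation is `x`.
  x-rank : (ps : List (Edge n)) → Unique ps → All (λ p → L p ≡ true) ps →
    # ps ≤ Σₑ (λ f → x f * [ covered ps f ])
  x-rank ps u Lps = begin
    # ps ≡⟨ sym (ℚP.*-identityˡ (# ps)) ⟩
    1ℚ * # ps ≡⟨ cong (_* # ps) (sym Σcoef≡1) ⟩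
    Σ[ allFin m ] (coef C) * # ps ≡⟨ sym (Σ-*ʳ (allFin m) (# ps) (coef C)) ⟩
    Σ[ allFin m ] (λ j → coef C j * # ps)
      ≤⟨ Σ-mono (allFin m) (λ j → *-monoˡ-≤ (ℚP.<⇒≤ (0<coef j)) (connected-rank (tree-connected j) ps u Lps)) ⟩
    Σ[ allFin m ] (λ j → coef C j * Σₑ (λ f → [ tree C j f ] * [ covered ps f ]))
      ≡⟨ Σ-expectation (edges n) (allFin m) (coef C) (λ j f → [ tree C j f ]) (λ f → [ covered ps f ]) ⟩
    Σₑ (λ f → Σ[ allFin m ] (λ j → coef C j * [ tree C j f ]) * [ covered ps f ])
      ≡⟨ Σ-cong (edges n) (λ f → cong (_* [ covered ps f ]) (x-expectation f)) ⟩
    Σₑ (λ f → x f * [ covered ps f ]) ∎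
    where
    open ℚP.≤-Reasoning

  -- In a lonely cut the only edge of `S` belongs to `L`, so no edge of `F` is left in it.
  big⇒¬lonely : (U : VSet n) → (1 ℕ.<ᵇ card (cutE x U ∩ᵉ F)) ≡ true → inQS S L (cutE x U) ≡ false
  big⇒¬lonely U big = BoolP.¬-not λ h →
    let (e , _ , le)          = any-elim {p = lonelyAt S L (cutE x U)} (edges n) h
        (Le , Se , Qe , one)  = lonelyAt-elim S L (cutE x U) le
        (g , h')              = nonempty (card (cutE x U ∩ᵉ F)) big refl
        (Qg , Fg)             = ∧-elim {cutE x U g} h'
        (Sg , ¬Lg)            = ∧-elim {S g} Fg
        g≡e                   = card-1⇒≡ {H = cutE x U ∩ᵉ S} one (∧-intro Qg Sg) (∧-intro Qe Se)
    in true≢false ¬Lg (cong not (trans (cong L g≡e) Le))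
    where
    nonempty : ∀ k → (1 ℕ.<ᵇ k) ≡ true → card (cutE x U ∩ᵉ F) ≡ k → ∃[ g ] (cutE x U ∩ᵉ F) g ≡ true
    nonempty (suc k) _ eq = card-suc⇒∃ {H = cutE x U ∩ᵉ F} eq

  -- By layeredness of S the cut U is wider than W e and W e', so a tree in which U is lonely
  -- has W e and W e' among its lonely cuts; these two cuts cannot share their lonely edge.
  wide⇒¬lonelyAt : ∀ {e e' f} → L e ≡ true → L e' ≡ true → e ≢ e' → δ (W e) f ≡ true → δ (W e') f ≡ true →
    (U : VSet n) → narrowᵇ x U ≡ true → inQS S L (cutE x U) ≡ false →
    ∀ j → lonelyAt (tree C j) (lonely C j) (cutE x U) f ≡ false
  wide⇒¬lonelyAt {e} {e'} {f} Le Le' e≢e' δf δf' U narrow ¬lonelyU j = BoolP.¬-not λ lonelyU →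
    let Sf  = proj₁ (proj₂ (lonelyAt-elim (tree C j) (lonely C j) (cutE x U) lonelyU))
        one  = inherit lonelyU e Le
        one' = inherit lonelyU e' Le'
        -- Both cuts meet tree `j` exactly in `f`, so the symmetric difference avoids that tree and
        -- must be trivial. Yet `e` lies in the first cut and not in the second.
        same = connected-constant (tree-connected j) (W e ⊻ W e') (λ g Sg → trans (δ-⊻ (W e) (W e') g)
                 (trans (cong₂ _xor_ (at-f e one Sf δf g Sg) (at-f e' one' Sf δf' g Sg)) (xor-self (g ==ᵉ f)))) (lo e) (hi e)
    in true≢false (trans (δ-⊻ (W e) (W e') e) (cong₂ _xor_ (proj₁ (proj₂ (fund e Le))) e∉W')) same
    where
    inherit : lonelyAt (tree C j) (lonely C j) (cutE x U) f ≡ true →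
      ∀ g → L g ≡ true → card (cutE x (W g) ∩ᵉ tree C j) ≡ 1
    inherit lonelyU g Lg =
      -- If the cut of `U` had mass at most that of `W g`, layeredness of `S` would make it lonely
      -- in `S`. So `W g` has the smaller mass and inherits loneliness in tree `j` from `U`.
      let narrower = ℚP.<⇒≤ (ℚP.≰⇒> λ U≤W → true≢false (tree-layered k (W g) U (proj₁ (W-lonely g Lg)) narrow
                        (any-intro (∈-edges g) (lonelyAt-W g Lg)) U≤W) ¬lonelyU)
          (_ , _ , lonelyW) = any-elim {p = lonelyAt (tree C j) (lonely C j) (cutE x (W g))} (edges n)
            (tree-layered j U (W g) narrow (proj₁ (W-lonely g Lg)) (any-intro (∈-edges f) lonelyU) narrower)
      in proj₂ (proj₂ (proj₂ (lonelyAt-elim (tree C j) (lonely C j) (cutE x (W g)) lonelyW)))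
    at-f : ∀ h → card (cutE x (W h) ∩ᵉ tree C j) ≡ 1 → tree C j f ≡ true → δ (W h) f ≡ true →
      ∀ g → tree C j g ≡ true → δ (W h) g ≡ (g ==ᵉ f)
    at-f h one Sf δf g Sg = case true-or-false (g ==ᵉ f) of λ where
      (inj₁ g=f) → trans (trans (cong (δ (W h)) (==ᵉ⇒≡ g f g=f)) δf) (sym g=f)
      (inj₂ g≠f) → trans (BoolP.¬-not λ δg → true≢false
        (subst (λ g' → (g' ==ᵉ f) ≡ true) (one-edge j (W h) one Sf δf Sg δg) (==ᵉ-refl f)) g≠f) (sym g≠f)
    e∉W' : δ (W e') e ≡ false
    e∉W' = BoolP.¬-not λ h → e≢e' (proj₂ (proj₂ (fund e' Le')) e (proj₁ (fund e Le)) h)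

  -- The tree `S` meets the two cuts in the different edges `e` and `e'`, so `f` is not in `S`; this
  -- kills the path term and the lonely term. A correction term belongs to a cut with at least two
  -- edges of `F`, which is not lonely in `S`, so `wide⇒¬lonelyAt` makes its `xQ` vanish at `f`.
  yF-doubly-covered : (P : ESet n) → IsTreePath S s t P → (γ : ℚ) → ∀ e e' f → L e ≡ true → L e' ≡ true →
    e ≢ e' → δ (W e) f ≡ true → δ (W e') f ≡ true → yF x C k P γ f ≡ ½ * x f
  yF-doubly-covered P path γ e e' f Le Le' e≢e' δf δf' = begin
    yF x C k P γ f
      ≡⟨ cong₂ _+_ (cong₂ _+_ (cong (λ b → ½ * x f + γ * [ b ]) f∉P) (Σ-zero (narrowCuts x) no-lonely))
                   (Σ-zero (narrowCuts x) no-correction) ⟩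
    ½ * x f + γ * 0ℚ + 0ℚ + 0ℚ
      ≡⟨ solve 2 (λ a g → a :+ g :* con 0ℚ :+ con 0ℚ :+ con 0ℚ := a) refl (½ * x f) γ ⟩
    ½ * x f ∎
    where
    open ≡-Reasoning
    open +-*-Solver
    f∉S : S f ≡ true → ⊥
    f∉S Sf = e≢e' (trans (sym (proj₂ (proj₂ (fund e Le)) f Sf δf)) (proj₂ (proj₂ (fund e' Le')) f Sf δf'))
    f∉P : P f ≡ false
    f∉P = BoolP.¬-not λ Pf → f∉S (proj₁ (proj₁ (path f) Pf))
    zero-indicator : ∀ a q b → b ≡ false → a * (q * [ b ]) ≡ 0ℚ
    zero-indicator a q b refl = trans (cong (a *_) (ℚP.*-zeroʳ q)) (ℚP.*-zeroʳ a)
    no-lonely : ∀ {Q} → Q ∈ narrowCuts x →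
      [ x ⟨ Q ⟩ <ᵇ (2ℚ - 2ℚ * γ) ] * ((1ℚ - ½ * x ⟨ Q ⟩ - γ) * [ lonelyAt S L Q f ]) ≡ 0ℚ
    no-lonely {Q} _ = zero-indicator [ x ⟨ Q ⟩ <ᵇ (2ℚ - 2ℚ * γ) ] (1ℚ - ½ * x ⟨ Q ⟩ - γ) (lonelyAt S L Q f)
      (BoolP.¬-not λ h → f∉S (proj₁ (proj₂ (lonelyAt-elim S L Q h))))
    zero-correction : ∀ a b q r → (b ≡ true → r ≡ 0ℚ) → [ a ∧ b ] * (q * r) ≡ 0ℚ
    zero-correction a false q r _ = trans (cong (λ b → [ b ] * (q * r)) (BoolP.∧-zeroʳ a)) (ℚP.*-zeroˡ (q * r))
    zero-correction a true  q r h = trans (cong (λ r → [ a ∧ true ] * (q * r)) (h refl))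
      (trans (cong ([ a ∧ true ] *_) (ℚP.*-zeroʳ q)) (ℚP.*-zeroʳ [ a ∧ true ]))
    xQ-zero : ∀ {Q} → ∃[ U ] (narrowᵇ x U ≡ true × Q ≡ cutE x U) → (1 ℕ.<ᵇ card (Q ∩ᵉ F)) ≡ true → xQ x C Q f ≡ 0ℚ
    xQ-zero (U , narrow , refl) big = Σ-zero (allFin m) λ {j} _ →
      trans (cong (λ b → coef C j * [ b ]) (wide⇒¬lonelyAt Le Le' e≢e' δf δf' U narrow (big⇒¬lonely U big) j))
            (ℚP.*-zeroʳ (coef C j))
    no-correction : ∀ {Q} → Q ∈ narrowCuts x →
      [ (x ⟨ Q ⟩ <ᵇ (2ℚ - 2ℚ * γ)) ∧ ((1 ℕ.<ᵇ card (Q ∩ᵉ F)) ∧ not (oddᵇ (card (Q ∩ᵉ F)))) ]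
        * (safeDiv (1ℚ - ½ * x ⟨ Q ⟩ - γ) (2ℚ - x ⟨ Q ⟩) * xQ x C Q f) ≡ 0ℚ
    no-correction {Q} Q∈ = zero-correction (x ⟨ Q ⟩ <ᵇ (2ℚ - 2ℚ * γ))
      ((1 ℕ.<ᵇ card (Q ∩ᵉ F)) ∧ not (oddᵇ (card (Q ∩ᵉ F))))
      (safeDiv (1ℚ - ½ * x ⟨ Q ⟩ - γ) (2ℚ - x ⟨ Q ⟩)) (xQ x C Q f)
      λ h → xQ-zero (∈-narrowCuts⁻ x Q∈) (proj₁ (∧-elim {1 ℕ.<ᵇ card (Q ∩ᵉ F)} h))

  module _ {J : ESet n} (s≢t : s ≢ t) (join : IsJoin (joinTarget F s t) J) where

    -- The only tree edge crossing `W e` is the lonely edge `e`, so `F` avoids this cut, and a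
    -- narrow cut separates `s` from `t`.
    join-crosses-lonely : ∀ e → L e ≡ true → ∃[ f ] (J f ≡ true × δ (W e) f ≡ true)
    join-crosses-lonely e Le = join-crosses s≢t {F} join (W e) (narrow⇒separates (W e) (proj₁ (W-lonely e Le)))
      λ g Fg → BoolP.¬-not λ δg →
        let (Sg , ¬Lg) = ∧-elim {S g} Fg
        in true≢false ¬Lg (cong not (trans (cong L (proj₂ (proj₂ (fund e Le)) g Sg δg)) Le))

    -- A cut avoiding all these edges contains only lonely edges of `S`, since it avoids `F`.
    -- Starting from an empty scanned list, `closed⇒supported` excludes those as well, and
    -- connectivity of `S` makes the cut trivial.
    connector-connects : (es : List (Edge n)) → All (λ e → L e ≡ true) es → (∀ e → L e ≡ true → e ∈ es) →
      ¬ ¬ Connected ((F ∪ᵉ J) ∪ᵉ connector J [] es)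
    connector-connects es Les complete = ¬¬-connected λ U closed →
      connected-constant (tree-connected k) U λ g Sg → BoolP.¬-not λ δg → case
        closed⇒supported J join-crosses-lonely U
          (λ f Jf → closed f (∨-introˡ (∨-introʳ (F f) Jf)))
          [] es [] Les
          (λ g h → closed g (∨-introʳ ((F ∪ᵉ J) g) h))
          (λ g Sg δg → inj₂ (complete g (case true-or-false (L g) of λ where
            (inj₁ Lg)  → Lg
            (inj₂ ¬Lg) → ⊥-elim (true≢false δg (closed g (∨-introˡ (∨-introˡ (∧-intro Sg (cong not ¬Lg)))))))))
          g Sg δg of λ ()

    -- The bought edges contain a spanning tree of the contracted graph, and `D` is a cheapest one.
    -- Comparison of rationals is decidable, which removes the double negations.
    min-connector-cost : {c : Edge n → ℚ} → (∀ e → 0ℚ ≤ c e) → {D : ESet n} → IsMinContractedST c (F ∪ᵉ J) D →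
      (es : List (Edge n)) → All (λ e → L e ≡ true) es → (∀ e → L e ≡ true → e ∈ es) →
      c ⟨ D ⟩ ≤ c ⟨ connector J [] es ⟩
    min-connector-cost {c} 0≤c {D} (_ , D-min) es Les complete = decidable-stable (c ⟨ D ⟩ ℚP.≤? c ⟨ connector J [] es ⟩)
      λ ¬le → connector-connects es Les complete λ conn → minimal-connector {G = F ∪ᵉ J} conn λ (D' , D'-st , D'⊆) →
        ¬le (ℚP.≤-trans (D-min D' D'-st) (mass-mono 0≤c D'⊆))

-- Sorting by decreasing cost

Σ-↭ : {xs ys : List A} (f : A → ℚ) → xs ↭ ys → Σ[ xs ] f ≡ Σ[ ys ] f
Σ-↭ f _↭_.refl = refl
Σ-↭ f (_↭_.prep a p) = cong (f a +_) (Σ-↭ f p)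
Σ-↭ {xs = _ ∷ _ ∷ xs} {ys = _ ∷ _ ∷ ys} f (_↭_.swap a b p) =
  trans (cong (λ q → f a + (f b + q)) (Σ-↭ f p))
    (solve 3 (λ a b r → a :+ (b :+ r) := b :+ (a :+ r)) refl (f a) (f b) (Σ[ ys ] f))
  where open +-*-Solver
Σ-↭ f (_↭_.trans p q) = trans (Σ-↭ f p) (Σ-↭ f q)

Σ-filterᵇ : (p : A → Bool) (xs : List A) (f : A → ℚ) → Σ[ filterᵇ p xs ] f ≡ Σ[ xs ] (λ a → [ p a ] * f a)
Σ-filterᵇ p [] f = refl
Σ-filterᵇ p (x ∷ xs) f with p x
... | true  = cong₂ _+_ (sym (ℚP.*-identityˡ (f x))) (Σ-filterᵇ p xs f)
... | false = trans (Σ-filterᵇ p xs f)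
  (sym (trans (cong (_+ Σ[ xs ] (λ a → [ p a ] * f a)) (ℚP.*-zeroˡ (f x))) (ℚP.+-identityˡ _)))

module ByCost {n : ℕ} (c : Edge n → ℚ) (L : ESet n) where

  dearerFirst : DecTotalOrder _ _ _
  dearerFirst = On.decTotalOrder (Flip.decTotalOrder ℚP.≤-decTotalOrder) c

  open Sort dearerFirst using (sort; sort-↭; sort-↗)

  sorted : List (Edge n)
  sorted = sort (filterᵇ L (edges n))

  sorted-descending : AllPairs (λ e e' → c e' ≤ c e) sorted
  sorted-descending = Sorted⇒AllPairs (DecTotalOrder.totalOrder dearerFirst) (sort-↗ (filterᵇ L (edges n)))

  sorted-unique : Unique sorted
  sorted-unique = Unique-resp-↭ (setoid (Edge n)) (↭⇒↭ₛ (↭-sym (sort-↭ (filterᵇ L (edges n)))))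
    (UniqueP.filter⁺ (BoolP.T? ∘ L) edges-unique)

  sorted-complete : ∀ e → L e ≡ true → e ∈ sorted
  sorted-complete e Le = ∈-resp-↭ (↭-sym (sort-↭ (filterᵇ L (edges n)))) (∈-filterᵇ⁺ L (∈-edges e) Le)

  sorted-sound : All (λ e → L e ≡ true) sorted
  sorted-sound = All.tabulate λ e∈ → proj₂ (∈-filterᵇ⁻ L {edges n} (∈-resp-↭ (sort-↭ (filterᵇ L (edges n))) e∈))

  Σ-sorted : (f : Edge n → ℚ) → Σ[ sorted ] f ≡ Σₑ (λ e → [ L e ] * f e)
  Σ-sorted f = trans (Σ-↭ f (sort-↭ (filterᵇ L (edges n)))) (Σ-filterᵇ L (edges n) f)

-- Expected cost of the doubled trees

theorem4 : {n : ℕ} (s t : Fin n) → s ≢ t →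
    (c : Edge n → ℚ) → Metric c →
    (x : Edge n → ℚ) → Optimal s t c x →
    {m : ℕ} (C : TreeComb n m) → IsLayered x C →
    (k : Fin m) →
    (P : ESet n) → IsTreePath (tree C k) s t P →
    (γ : ℚ) → 0ℚ ≤ γ → γ ≤ ½ →
    {r : ℕ} (μ : Fin r → ℚ) (J : Fin r → ESet n) →
    (∀ j → 0ℚ < μ j) → Σ[ allFin r ] μ ≡ 1ℚ →
    (∀ j → IsJoin (joinTarget (tree C k ∖ᵉ lonely C k) s t) (J j)) →
    (∀ e → Σ[ allFin r ] (λ j → μ j * [ J j e ]) ≡ yF x C k P γ e) →
    (D : Fin r → ESet n) →
    (∀ j → IsMinContractedST c ((tree C k ∖ᵉ lonely C k) ∪ᵉ J j) (D j)) →
    Σ[ allFin r ] (λ j → μ j * (2ℚ * c ⟨ D j ⟩))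
    ≤ rhsBound x c (tree C k) (lonely C k)
theorem4 {n} s t s≢t c (0≤c , _) x (feas , _) {m} C layered k P path γ _ _ {r} μ J 0<μ _ join yF≡ D D-min = begin
  Σ[ allFin r ] (λ j → μ j * (2ℚ * c ⟨ D j ⟩))
    ≡⟨ Σ-cong (allFin r) (λ j → commute (μ j) (c ⟨ D j ⟩)) ⟩
  Σ[ allFin r ] (λ j → 2ℚ * (μ j * c ⟨ D j ⟩))
    ≡⟨ Σ-*ˡ (allFin r) 2ℚ (λ j → μ j * c ⟨ D j ⟩) ⟩
  2ℚ * Σ[ allFin r ] (λ j → μ j * c ⟨ D j ⟩)
    ≤⟨ *-monoˡ-≤ (ℚP.nonNegative⁻¹ 2ℚ) (Σ-mono (allFin r) (λ j → *-monoˡ-≤ (ℚP.<⇒≤ (0<μ j)) (D-cost j))) ⟩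
  2ℚ * Σ[ allFin r ] (λ j → μ j * Σₑ (λ f → [ J j f ] * w f))
    ≡⟨ cong (2ℚ *_) (Σ-expectation (edges n) (allFin r) μ (λ j f → [ J j f ]) w) ⟩
  2ℚ * Σₑ (λ f → Σ[ allFin r ] (λ j → μ j * [ J j f ]) * w f)
    -- The weight `w` vanishes except on edges in two lonely cuts, and there the expected join is
    -- half of `x`. This half then cancels the doubling of the tree.
    ≡⟨ cong (2ℚ *_) (Σ-cong (edges n) (λ f → trans (cong (_* w f) (yF≡ f)) (yF-halves f))) ⟩
  2ℚ * Σₑ (λ f → ½ * x f * w f)
    ≡⟨ sym (Σ-*ˡ (edges n) 2ℚ (λ f → ½ * x f * w f)) ⟩
  Σₑ (λ f → 2ℚ * (½ * x f * w f))
    ≡⟨ Σ-cong (edges n) (λ f → double-half (x f) (w f)) ⟩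
  Σₑ (λ f → x f * w f)
    ≤⟨ total-weight-bound x x-rank sorted sorted-unique sorted-sound sorted-descending ⟩
  Σ[ sorted ] (λ e → (x ⟨ δ (W e) ⟩ - 1ℚ) * c e)
    ≡⟨ Σ-sorted (λ e → (x ⟨ δ (W e) ⟩ - 1ℚ) * c e) ⟩
  Σₑ (λ e → [ L e ] * ((x ⟨ δ (W e) ⟩ - 1ℚ) * c e))
    ≤⟨ rhsBound-≥ 0≤c S L W (λ e Le → proj₁ (W-lonely e Le) , lonelyAt-W e Le) ⟩
  rhsBound x c S L ∎
  where
  open ℚP.≤-Reasoning
  open FeasibleCuts s t x feas
  open LayeredTree s t x feas C layered k
  open LonelyCost S L (tree-connected k) W fund c 0≤c
  open ByCost c L
  open +-*-Solver using (solve; _:*_; _:=_; con)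
  w : Edge n → ℚ
  w = weight [] sorted
  commute : ∀ a b → a * (2ℚ * b) ≡ 2ℚ * (a * b)
  commute = solve 2 (λ a b → a :* (con 2ℚ :* b) := con 2ℚ :* (a :* b)) refl
  double-half : ∀ a b → 2ℚ * (½ * a * b) ≡ a * b
  double-half = solve 2 (λ a b → con 2ℚ :* (con ½ :* a :* b) := a :* b) refl
  D-cost : ∀ j → c ⟨ D j ⟩ ≤ Σₑ (λ f → [ J j f ] * w f)
  D-cost j = ℚP.≤-trans (min-connector-cost s≢t (join j) 0≤c (D-min j) sorted sorted-sound sorted-complete)
    (connector-cost (J j) [] sorted)
  yF-halves : ∀ f → yF x C k P γ f * w f ≡ ½ * x f * w f
  yF-halves = weight-cong {yF x C k P γ} {λ f → ½ * x f} (yF-doubly-covered P path γ) sorted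
    (record { ps-unique = [] ; es-unique = sorted-unique ; disjoint = λ _ () ; ps-lonely = [] ; es-lonely = sorted-sound })
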